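{- Write $n(s):=n_5(5,2;s)$. The following bounds and exact values hold. (1) For $2\le s\le 31$: $27\le n(2)\le 31$; $50\le n(3)\le 62$; $77\le n(4)\le 93$; $n(5)=125$; $132\le n(6)\le 146$; $157\le n(7)\le 172$; $176\le n(8)\le 198$; $202\le n(9)\le 224$; $n(10)=250$; $260\le n(11)\le 271$; $286\le n(12)\le 297$; $308\le n(13)\le 323$; $330\le n(14)\le 349$; $n(15)=375$; $391\le n(16)\le 396$; $412\le n(17)\le 422$; $433\le n(18)\le 448$; $455\le n(19)\le 474$; $n(20)=500$; $n(21)=521$; $542\le n(22)\le 547$; $568\le n(23)\le 573$; $594\le n(24)\le 599$; $n(25)=625$; $n(26)=651$; $667\le n(27)\le 677$; $693\le n(28)\le 703$; $719\le n(29)\le 729$; $n(30)=755$; $n(31)=781$. (2) For $32\le s\le 62$: $792\le n(32)\le 802$; $818\le n(33)\le 828$; $844\le n(34)\le 854$; $n(35)=880$; $n(36)=906$; $n(37)=927$; $941\le n(38)\le 953$; $969\le n(39)\le 979$; $n(40)=1005$; $n(41)=1031$; $n(42)=1052$; $1067\le n(43)\le 1078$; $1096\le n(44)\le 1104$; $n(45)=1130$; $n(46)=1156$; $n(47)=1177$; $n(48)=1203$; $1224\le n(49)\le 1229$; $n(50)=1255$; $n(51)=1281$; $n(52)=1302$; $n(53)=1328$; $n(54)=1354$; $n(55)=1380$; $n(56)=1406$; $n(57)=1432$; $n(58)=1458$; $n(59)=1484$; $n(60)=1510$; $n(61)=1536$; $n(62)=1562$. (3) For every integer $t\ge 3$: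 $n(31t-30)=781t-760$; $n(31t-29)=781t-734$; $n(31t-28)=781t-708$; $n(31t-27)=781t-682$; $n(31t-26)=781t-656$; $n(31t-25)=781t-635$; $n(31t-24)=781t-609$; $n(31t-23)=781t-583$; $n(31t-22)=781t-557$; $n(31t-21)=781t-531$; $n(31t-20)=781t-510$; $n(31t-19)=781t-484$; $n(31t-18)=781t-458$; $n(31t-17)=781t-432$; $n(31t-16)=781t-406$; $n(31t-15)=781t-385$; $n(31t-14)=781t-359$; $n(31t-13)=781t-333$; $n(31t-12)=781t-307$; $n(31t-11)=781t-281$; $n(31t-10)=781t-260$; $n(31t-9)=781t-234$; $n(31t-8)=781t-208$; $n(31t-7)=781t-182$; $n(31t-6)=781t-156$; $n(31t-5)=781t-130$; $n(31t-4)=781t-104$; $n(31t-3)=781t-78$; $n(31t-2)=781t-52$; $n(31t-1)=781t-26$; $n(31t)=781t$.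
   Context: All dimensions are vector-space dimensions; a hyperplane of $\mathbb{F}_q^r$ is an $(r-1)$-dimensional subspace. A projective $h-(n,r,s)_q$ system is a multiset of $n$ subspaces of $\mathbb{F}_q^r$, each of dimension at most $h$, such that each hyperplane contains at most $s$ of these subspaces (counted with multiplicity) and some hyperplane contains exactly $s$ of them. $n_q(r,h;s)$ denotes the maximum $n$ such that a projective $h-(n,r,s)_q$ system exists. -}

module Defs where

open import Data.Fin using (Fin; zero; suc; toℕ)
open import Data.Fin.Properties using (all?)
open import Data.Nat using (ℕ; zero; suc; pred; _+_; _*_; _≤_)
open import Data.Nat.DivMod using (_mod_)
open import Data.Product using (_×_; _,_; ∃-syntax)
open import Data.Vec using (Vec; []; _∷_; zipWith; map; replicate; foldr′; count)
open import Data.Vec.Relation.Unary.All using (All)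
open import Level using (0ℓ)
open import Relation.Binary.PropositionalEquality using (_≡_)
open import Relation.Nullary using (Dec; map′; _→-dec_)
open import Relation.Unary using (Pred; Decidable; _∈_; _⊆_)

private
  variable
    k n r : ℕ

𝔽₅ : Set
𝔽₅ = Fin 5

infixl 6 _+₅_ _+ᵛ_
infixl 7 _*₅_ _·ᵛ_

_+₅_ : 𝔽₅ → 𝔽₅ → 𝔽₅
a +₅ b = (toℕ a + toℕ b) mod 5

_*₅_ : 𝔽₅ → 𝔽₅ → 𝔽₅
a *₅ b = (toℕ a * toℕ b) mod 5

Vector : ℕ → Set
Vector r = Vec 𝔽₅ r

0ᵛ : Vector r
0ᵛ = replicate _ zero

_+ᵛ_ : Vector r → Vector r → Vector r
_+ᵛ_ = zipWith _+₅_

_·ᵛ_ : 𝔽₅ → Vector r → Vector r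
a ·ᵛ v = map (a *₅_) v

-- Decidability of membership holds for every subspace classically; it is
-- required here so that the subspaces inside a hyperplane can be counted.
record Subspace (r : ℕ) : Set₁ where
  field
    Carrier  : Pred (Vector r) 0ℓ
    carrier? : Decidable Carrier
    0-closed : 0ᵛ ∈ Carrier
    +-closed : ∀ {u v} → u ∈ Carrier → v ∈ Carrier → u +ᵛ v ∈ Carrier
    ·-closed : ∀ a {v} → v ∈ Carrier → a ·ᵛ v ∈ Carrier

open Subspace

linearCombination : Vec 𝔽₅ k → Vec (Vector r) k → Vector r
linearCombination cs vs = foldr′ _+ᵛ_ 0ᵛ (zipWith _·ᵛ_ cs vs)

LinearlyIndependent : Vec (Vector r) k → Set
LinearlyIndependent vs = ∀ cs → linearCombination cs vs ≡ 0ᵛ → cs ≡ replicate _ zero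

record IsBasis (S : Subspace r) (vs : Vec (Vector r) k) : Set where
  field
    members     : All (_∈ Carrier S) vs
    independent : LinearlyIndependent vs
    spanning    : ∀ {v} → v ∈ Carrier S → ∃[ cs ] linearCombination cs vs ≡ v

HasDimension : Subspace r → ℕ → Set
HasDimension {r} S d = ∃[ vs ] IsBasis {r} {d} S vs

IsHyperplane : Subspace r → Set
IsHyperplane {r} H = HasDimension H (pred r)

infix 4 _⊆ˢ_ _⊆ˢ?_

_⊆ˢ_ : Subspace r → Subspace r → Set
S ⊆ˢ T = Carrier S ⊆ Carrier T

allVectors? : {P : Pred (Vector r) 0ℓ} → Decidable P → Dec (∀ v → P v)
allVectors? {zero}  P? = map′ (λ { p [] → p }) (λ p → p []) (P? [])
allVectors? {suc r} P? =
  map′ (λ { p (a ∷ v) → p a v }) (λ p a v → p (a ∷ v))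
       (all? λ a → allVectors? λ v → P? (a ∷ v))

_⊆ˢ?_ : (S T : Subspace r) → Dec (S ⊆ˢ T)
S ⊆ˢ? T = map′ (λ f {v} → f v) (λ f v → f {v})
               (allVectors? λ v → carrier? S v →-dec carrier? T v)

-- A multiset of n subspaces is listed as a vector; the order is immaterial and
-- repetitions are counted with multiplicity.
numberInside : Subspace r → Vec (Subspace r) n → ℕ
numberInside H = count (_⊆ˢ? H)

record IsProjectiveSystem (r h s : ℕ) (𝒮 : Vec (Subspace r) n) : Set₁ where
  field
    dimension≤h : All (λ S → ∃[ d ] (d ≤ h × HasDimension S d)) 𝒮
    inside≤s    : ∀ H → IsHyperplane H → numberInside H 𝒮 ≤ s
    attained    : ∃[ H ] (IsHyperplane H × numberInside H 𝒮 ≡ s)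

SystemExists : (r h s n : ℕ) → Set₁
SystemExists r h s n = ∃[ 𝒮 ] IsProjectiveSystem {n} r h s 𝒮

-- The graph of the partial function (r , h , s) ↦ n₅(r,h;s).
record IsMaximumSize (r h s n : ℕ) : Set₁ where
  field
    exists  : SystemExists r h s n
    maximal : ∀ m → SystemExists r h s m → m ≤ n

infix 4 n⟨_⟩≡_ _≤n⟨_⟩≤_

n⟨_⟩≡_ : ℕ → ℕ → Set₁
n⟨ s ⟩≡ k = IsMaximumSize 5 2 s k

_≤n⟨_⟩≤_ : ℕ → ℕ → ℕ → Set₁
lo ≤n⟨ s ⟩≤ hi = ∃[ k ] (n⟨ s ⟩≡ k × lo ≤ k × k ≤ hi)

{-# OPTIONS --safe #-}
-- A list of lines such that each hyperplane u^⊥ contains at most s of them is an "arrangement".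
-- n(s) is the largest size of an arrangement, which exists constructively because a finite search
-- decides each size: a largest arrangement has a hyperplane with exactly s lines, as otherwise
-- any line could be added.
--
-- Upper bounds.  The 6n points on the n lines form a linear code of dimension 5 and minimum
-- distance at least 5(n − s), so Griesmer's bound applies.  For s = 2, 3, 4 it is too weak.  There,
-- counting the lines in the hyperplanes through one line gives n ≤ 31(s − 1) + 1, and in the
-- case of equality every hyperplane contains 0 or s lines; summing over the functionals with
-- value 1 at a point P of one line yields s ∣ 25 · 31 (s − 1), a contradiction.
--
-- Lower bounds.  Fix a plane π.  An MRD code gives 125 lines disjoint from π, five in each
-- hyperplane not containing π and none in the six solids H₁, …, H₆ through π.  A line spread of Hᵢ
-- has 26 lines in Hᵢ and one in any other hyperplane.  So k copies of the former and bᵢ spreads of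
-- Hᵢ with 5 bᵢ ≤ k form an arrangement with s = 5k + Σ bᵢ and n = 125k + 26 Σ bᵢ.  This
-- is optimal for every s ≥ 25; smaller values of s use partial spreads or explicit
-- arrangements, most of them unions of orbits of a small matrix group.
module Submission where

open import Defs
open import Data.Bool using (Bool; true; false; if_then_else_; T; _∧_; _∨_)
open import Data.Fin using (Fin; zero; suc; toℕ)
open import Data.Fin.Properties using (all?; any?; toℕ-fromℕ<; _≟_)
open import Data.List using (List; []; _∷_; _++_; concatMap; filter; iterate; length; map; take; upTo)
open import Data.List.Membership.Propositional using (_∈_)
open import Data.List.Properties using (length-++; length-map; length-take)
open import Data.List.Relation.Unary.All using (All; []; _∷_)
open import Data.List.Relation.Unary.Any using (here; there)
open import Data.Nat using (ℕ; zero; suc; _+_; _*_; _∸_; _^_; _≤_; _<_; _≤ᵇ_; _<ᵇ_; _≡ᵇ_; z≤n; s≤s)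
open import Data.Nat.DivMod
  using (_/_; _%_; _mod_; /-monoˡ-≤; +-distrib-/-∣ˡ; m*n/n≡m; m<n*o⇒m/o<n; m%n<n; %-distribˡ-+; %-distribˡ-*)
open import Data.Nat.Divisibility using (_∣_; _∣?_; _∣0; ∣-refl; ∣m∣n⇒∣m+n; ∣n⇒∣m*n; m∣m*n)
open import Data.Nat.ListAction using (sum)
open import Data.Nat.Properties hiding (_≟_)
open import Data.Nat.Properties using () renaming (_≟_ to _≟ℕ_)
open import Data.Nat.Tactic.RingSolver using (solve-∀)
open import Data.Product using (_×_; _,_; ∃-syntax; proj₁; proj₂)
open import Data.Sum using (_⊎_; inj₁; inj₂; [_,_]′)
open import Data.Vec using (Vec; []; _∷_; fromList; insertAt; lookup; toList)
import Data.Vec as Vec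
open import Data.Vec.Properties using (∷-injective; length-toList; toList∘fromList; ≡-dec)
import Data.Vec.Relation.Unary.All as VecAll
import Data.Vec.Relation.Unary.All.Properties as VecAll
open import Function using (_∘_; id)
open import Relation.Binary.PropositionalEquality
open import Relation.Nullary using (Dec; yes; no; does; ¬_; contradiction; map′)
open import Relation.Nullary.Decidable using (dec-false; dec-true; from-no; from-yes; ¬?; _×-dec_; _→-dec_)
open import Relation.Unary using (Decidable)

open Subspace
open IsBasis

private
  variable
    c c′ d hi k lo m n n′ r s s′ t t′ : ℕ
    A B X : Set

-- The field 𝔽₅, vectors and the dot product

pattern 0₅ = zero
pattern 1₅ = suc zero
pattern 2₅ = suc (suc zero)
pattern 3₅ = suc (suc (suc zero))
pattern 4₅ = suc (suc (suc (suc zero)))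

infix 4 _≟ᵛ_

_≟ᵛ_ : (u v : Vector r) → Dec (u ≡ v)
_≟ᵛ_ = ≡-dec _≟_

abstract
  -- The field laws are finite statements, decided by running through all cases.
  +₅-assoc : ∀ a b c → (a +₅ b) +₅ c ≡ a +₅ (b +₅ c)
  +₅-assoc = from-yes (all? λ a → all? λ b → all? λ c → (a +₅ b) +₅ c ≟ a +₅ (b +₅ c))

  +₅-comm : ∀ a b → a +₅ b ≡ b +₅ a
  +₅-comm = from-yes (all? λ a → all? λ b → a +₅ b ≟ b +₅ a)

  +₅-identityˡ : ∀ a → 0₅ +₅ a ≡ a
  +₅-identityˡ = from-yes (all? λ a → 0₅ +₅ a ≟ a)

  +₅-identityʳ : ∀ a → a +₅ 0₅ ≡ a
  +₅-identityʳ = from-yes (all? λ a → a +₅ 0₅ ≟ a)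

  *₅-assoc : ∀ a b c → (a *₅ b) *₅ c ≡ a *₅ (b *₅ c)
  *₅-assoc = from-yes (all? λ a → all? λ b → all? λ c → (a *₅ b) *₅ c ≟ a *₅ (b *₅ c))

  *₅-comm : ∀ a b → a *₅ b ≡ b *₅ a
  *₅-comm = from-yes (all? λ a → all? λ b → a *₅ b ≟ b *₅ a)

  *₅-identityˡ : ∀ a → 1₅ *₅ a ≡ a
  *₅-identityˡ = from-yes (all? λ a → 1₅ *₅ a ≟ a)

  *₅-zeroʳ : ∀ a → a *₅ 0₅ ≡ 0₅
  *₅-zeroʳ = from-yes (all? λ a → a *₅ 0₅ ≟ 0₅)

  *₅-distribˡ-+₅ : ∀ a b c → a *₅ (b +₅ c) ≡ a *₅ b +₅ a *₅ c
  *₅-distribˡ-+₅ = from-yes (all? λ a → all? λ b → all? λ c → a *₅ (b +₅ c) ≟ a *₅ b +₅ a *₅ c)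

  *₅-distribʳ-+₅ : ∀ a b c → (a +₅ b) *₅ c ≡ a *₅ c +₅ b *₅ c
  *₅-distribʳ-+₅ = from-yes (all? λ a → all? λ b → all? λ c → (a +₅ b) *₅ c ≟ a *₅ c +₅ b *₅ c)

  inverse₅ : ∀ a → a ≢ 0₅ → ∃[ b ] b *₅ a ≡ 1₅
  inverse₅ = from-yes (all? λ a → ¬? (a ≟ 0₅) →-dec any? λ b → b *₅ a ≟ 1₅)

  *₅-nonzero : ∀ a b → a ≢ 0₅ → a *₅ b ≡ 0₅ → b ≡ 0₅
  *₅-nonzero = from-yes (all? λ a → all? λ b → ¬? (a ≟ 0₅) →-dec ((a *₅ b ≟ 0₅) →-dec (b ≟ 0₅)))

+₅-interchange : ∀ a b c d → (a +₅ b) +₅ (c +₅ d) ≡ (a +₅ c) +₅ (b +₅ d)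
+₅-interchange a b c d = begin
  (a +₅ b) +₅ (c +₅ d) ≡⟨ +₅-assoc a b (c +₅ d) ⟩
  a +₅ (b +₅ (c +₅ d)) ≡⟨ cong (a +₅_) (+₅-assoc b c d) ⟨
  a +₅ ((b +₅ c) +₅ d) ≡⟨ cong (λ z → a +₅ (z +₅ d)) (+₅-comm b c) ⟩
  a +₅ ((c +₅ b) +₅ d) ≡⟨ cong (a +₅_) (+₅-assoc c b d) ⟩
  a +₅ (c +₅ (b +₅ d)) ≡⟨ +₅-assoc a c (b +₅ d) ⟨
  (a +₅ c) +₅ (b +₅ d) ∎
  where open ≡-Reasoning

+ᵛ-identityˡ : (v : Vector r) → 0ᵛ +ᵛ v ≡ v
+ᵛ-identityˡ []      = refl
+ᵛ-identityˡ (a ∷ v) = cong₂ _∷_ (+₅-identityˡ a) (+ᵛ-identityˡ v)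

+ᵛ-identityʳ : (v : Vector r) → v +ᵛ 0ᵛ ≡ v
+ᵛ-identityʳ []      = refl
+ᵛ-identityʳ (a ∷ v) = cong₂ _∷_ (+₅-identityʳ a) (+ᵛ-identityʳ v)

+ᵛ-interchange : (a b c d : Vector r) → (a +ᵛ b) +ᵛ (c +ᵛ d) ≡ (a +ᵛ c) +ᵛ (b +ᵛ d)
+ᵛ-interchange []      []      []      []      = refl
+ᵛ-interchange (x ∷ a) (y ∷ b) (z ∷ c) (w ∷ d) =
  cong₂ _∷_ (+₅-interchange x y z w) (+ᵛ-interchange a b c d)

·ᵛ-zeroˡ : (v : Vector r) → 0₅ ·ᵛ v ≡ 0ᵛ
·ᵛ-zeroˡ []      = refl
·ᵛ-zeroˡ (a ∷ v) = cong (0₅ ∷_) (·ᵛ-zeroˡ v)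

·ᵛ-zeroʳ : ∀ a → a ·ᵛ 0ᵛ {r} ≡ 0ᵛ
·ᵛ-zeroʳ {zero}  a = refl
·ᵛ-zeroʳ {suc r} a = cong₂ _∷_ (*₅-zeroʳ a) (·ᵛ-zeroʳ a)

·ᵛ-identity : (v : Vector r) → 1₅ ·ᵛ v ≡ v
·ᵛ-identity []      = refl
·ᵛ-identity (a ∷ v) = cong₂ _∷_ (*₅-identityˡ a) (·ᵛ-identity v)

·ᵛ-assoc : ∀ a b (v : Vector r) → (a *₅ b) ·ᵛ v ≡ a ·ᵛ (b ·ᵛ v)
·ᵛ-assoc a b []      = refl
·ᵛ-assoc a b (x ∷ v) = cong₂ _∷_ (*₅-assoc a b x) (·ᵛ-assoc a b v)

·ᵛ-distribˡ : ∀ a (u v : Vector r) → a ·ᵛ (u +ᵛ v) ≡ a ·ᵛ u +ᵛ a ·ᵛ v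
·ᵛ-distribˡ a []      []      = refl
·ᵛ-distribˡ a (x ∷ u) (y ∷ v) = cong₂ _∷_ (*₅-distribˡ-+₅ a x y) (·ᵛ-distribˡ a u v)

·ᵛ-distribʳ : ∀ a b (v : Vector r) → (a +₅ b) ·ᵛ v ≡ a ·ᵛ v +ᵛ b ·ᵛ v
·ᵛ-distribʳ a b []      = refl
·ᵛ-distribʳ a b (x ∷ v) = cong₂ _∷_ (*₅-distribʳ-+₅ a b x) (·ᵛ-distribʳ a b v)

dot : Vector r → Vector r → 𝔽₅
dot []      []      = 0₅
dot (a ∷ u) (b ∷ v) = a *₅ b +₅ dot u v

dot-comm : (u v : Vector r) → dot u v ≡ dot v u
dot-comm []      []      = refl
dot-comm (a ∷ u) (b ∷ v) = cong₂ _+₅_ (*₅-comm a b) (dot-comm u v)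

dot-+ᵛʳ : (u v w : Vector r) → dot u (v +ᵛ w) ≡ dot u v +₅ dot u w
dot-+ᵛʳ []      []      []      = refl
dot-+ᵛʳ (a ∷ u) (b ∷ v) (c ∷ w) = trans
  (cong₂ _+₅_ (*₅-distribˡ-+₅ a b c) (dot-+ᵛʳ u v w))
  (+₅-interchange (a *₅ b) (a *₅ c) (dot u v) (dot u w))

dot-·ᵛʳ : ∀ (u : Vector r) a v → dot u (a ·ᵛ v) ≡ a *₅ dot u v
dot-·ᵛʳ []      a []      = sym (*₅-zeroʳ a)
dot-·ᵛʳ (x ∷ u) a (y ∷ v) = begin
  x *₅ (a *₅ y) +₅ dot u (a ·ᵛ v) ≡⟨ cong₂ _+₅_ (sym (*₅-assoc x a y)) (dot-·ᵛʳ u a v) ⟩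
  (x *₅ a) *₅ y +₅ a *₅ dot u v   ≡⟨ cong (λ z → z *₅ y +₅ a *₅ dot u v) (*₅-comm x a) ⟩
  (a *₅ x) *₅ y +₅ a *₅ dot u v   ≡⟨ cong (_+₅ a *₅ dot u v) (*₅-assoc a x y) ⟩
  a *₅ (x *₅ y) +₅ a *₅ dot u v   ≡⟨ *₅-distribˡ-+₅ a (x *₅ y) (dot u v) ⟨
  a *₅ (x *₅ y +₅ dot u v)        ∎
  where open ≡-Reasoning

dot-0ᵛʳ : (u : Vector r) → dot u 0ᵛ ≡ 0₅
dot-0ᵛʳ []      = refl
dot-0ᵛʳ (a ∷ u) = trans (cong₂ _+₅_ (*₅-zeroʳ a) (dot-0ᵛʳ u)) (+₅-identityˡ 0₅)

dot-0ᵛˡ : (v : Vector r) → dot 0ᵛ v ≡ 0₅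
dot-0ᵛˡ v = trans (dot-comm 0ᵛ v) (dot-0ᵛʳ v)

dot-+ᵛˡ : (u v w : Vector r) → dot (u +ᵛ v) w ≡ dot u w +₅ dot v w
dot-+ᵛˡ u v w = trans (dot-comm (u +ᵛ v) w)
  (trans (dot-+ᵛʳ w u v) (cong₂ _+₅_ (dot-comm w u) (dot-comm w v)))

dot-·ᵛˡ : ∀ a (u w : Vector r) → dot (a ·ᵛ u) w ≡ a *₅ dot u w
dot-·ᵛˡ a u w = trans (dot-comm (a ·ᵛ u) w) (trans (dot-·ᵛʳ w a u) (cong (a *₅_) (dot-comm w u)))

[_≡0] : 𝔽₅ → ℕ
[ zero  ≡0] = 1
[ suc _ ≡0] = 0

[_≢0] : 𝔽₅ → ℕ
[ zero  ≢0] = 0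
[ suc _ ≢0] = 1

[≡0]≤1 : ∀ a → [ a ≡0] ≤ 1
[≡0]≤1 zero    = ≤-refl
[≡0]≤1 (suc _) = z≤n

-- Sums over lists and over all vectors

Σ[_] : List A → (A → ℕ) → ℕ
Σ[ xs ] f = sum (map f xs)

Σ-cong : (xs : List A) {f g : A → ℕ} → (∀ x → f x ≡ g x) → Σ[ xs ] f ≡ Σ[ xs ] g
Σ-cong []       eq = refl
Σ-cong (x ∷ xs) eq = cong₂ _+_ (eq x) (Σ-cong xs eq)

Σ-*ˡ : ∀ c (xs : List A) (f : A → ℕ) → Σ[ xs ] (λ x → c * f x) ≡ c * Σ[ xs ] f
Σ-*ˡ c []       f = sym (*-zeroʳ c)
Σ-*ˡ c (x ∷ xs) f = trans (cong (c * f x +_) (Σ-*ˡ c xs f)) (sym (*-distribˡ-+ c (f x) _))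

Σ-++ : (xs ys : List A) (f : A → ℕ) → Σ[ xs ++ ys ] f ≡ Σ[ xs ] f + Σ[ ys ] f
Σ-++ []       ys f = refl
Σ-++ (x ∷ xs) ys f = trans (cong (f x +_) (Σ-++ xs ys f)) (sym (+-assoc (f x) _ _))

Σ₅ : (𝔽₅ → ℕ) → ℕ
Σ₅ f = f 0₅ + (f 1₅ + (f 2₅ + (f 3₅ + f 4₅)))

Σ₅-cong : {f g : 𝔽₅ → ℕ} → (∀ a → f a ≡ g a) → Σ₅ f ≡ Σ₅ g
Σ₅-cong eq = cong₂ _+_ (eq 0₅) (cong₂ _+_ (eq 1₅) (cong₂ _+_ (eq 2₅) (cong₂ _+_ (eq 3₅) (eq 4₅))))

Σ₅-+ : ∀ (f g : 𝔽₅ → ℕ) → Σ₅ (λ a → f a + g a) ≡ Σ₅ f + Σ₅ g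
Σ₅-+ f g = regroup (f 0₅) (f 1₅) (f 2₅) (f 3₅) (f 4₅) (g 0₅) (g 1₅) (g 2₅) (g 3₅) (g 4₅)
  where
  regroup : ∀ a b c d e a′ b′ c′ d′ e′ →
    a + a′ + (b + b′ + (c + c′ + (d + d′ + (e + e′)))) ≡
    a + (b + (c + (d + e))) + (a′ + (b′ + (c′ + (d′ + e′))))
  regroup = solve-∀

Σ₅-swap : (f : 𝔽₅ → 𝔽₅ → ℕ) → Σ₅ (λ a → Σ₅ (λ b → f a b)) ≡ Σ₅ (λ b → Σ₅ (λ a → f a b))
Σ₅-swap f = sym (begin
  Σ₅ (λ b → Σ₅ λ a → f a b)                        ≡⟨ Σ₅-+ (f 0₅) (λ b → f 1₅ b + tail₂ b) ⟩
  Σ₅ (f 0₅) + Σ₅ (λ b → f 1₅ b + tail₂ b)           ≡⟨ cong (Σ₅ (f 0₅) +_) (Σ₅-+ (f 1₅) tail₂) ⟩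
  Σ₅ (f 0₅) + (Σ₅ (f 1₅) + Σ₅ tail₂)                ≡⟨ cong (λ z → Σ₅ (f 0₅) + (Σ₅ (f 1₅) + z)) (Σ₅-+ (f 2₅) tail₃) ⟩
  Σ₅ (f 0₅) + (Σ₅ (f 1₅) + (Σ₅ (f 2₅) + Σ₅ tail₃)) ≡⟨ cong (λ z → Σ₅ (f 0₅) + (Σ₅ (f 1₅) + (Σ₅ (f 2₅) + z))) (Σ₅-+ (f 3₅) (f 4₅)) ⟩
  Σ₅ (λ a → Σ₅ (f a))                              ∎)
  where
  open ≡-Reasoning
  tail₃ tail₂ : 𝔽₅ → ℕ
  tail₃ b = f 3₅ b + f 4₅ b
  tail₂ b = f 2₅ b + tail₃ b

Σ₅-shift : ∀ (f : 𝔽₅ → ℕ) c → Σ₅ (λ a → f (c +₅ a)) ≡ Σ₅ f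
Σ₅-shift f = λ
  { 0₅ → refl
  ; 1₅ → rot₁ (f 0₅) (f 1₅) (f 2₅) (f 3₅) (f 4₅)
  ; 2₅ → rot₂ (f 0₅) (f 1₅) (f 2₅) (f 3₅) (f 4₅)
  ; 3₅ → rot₃ (f 0₅) (f 1₅) (f 2₅) (f 3₅) (f 4₅)
  ; 4₅ → rot₄ (f 0₅) (f 1₅) (f 2₅) (f 3₅) (f 4₅) }
  where
  rot₁ : ∀ a b c d e → b + (c + (d + (e + a))) ≡ a + (b + (c + (d + e)))
  rot₁ = solve-∀
  rot₂ : ∀ a b c d e → c + (d + (e + (a + b))) ≡ a + (b + (c + (d + e)))
  rot₂ = solve-∀
  rot₃ : ∀ a b c d e → d + (e + (a + (b + c))) ≡ a + (b + (c + (d + e)))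
  rot₃ = solve-∀
  rot₄ : ∀ a b c d e → e + (a + (b + (c + d))) ≡ a + (b + (c + (d + e)))
  rot₄ = solve-∀

Σ₅≡0⇒≡0 : (f : 𝔽₅ → ℕ) → Σ₅ f ≡ 0 → ∀ a → f a ≡ 0
Σ₅≡0⇒≡0 f eq = λ
  { 0₅ → m+n≡0⇒m≡0 _ eq
  ; 1₅ → m+n≡0⇒m≡0 _ tail₁
  ; 2₅ → m+n≡0⇒m≡0 _ tail₂
  ; 3₅ → m+n≡0⇒m≡0 _ tail₃
  ; 4₅ → m+n≡0⇒n≡0 (f 3₅) tail₃ }
  where
  tail₁ = m+n≡0⇒n≡0 (f 0₅) eq
  tail₂ = m+n≡0⇒n≡0 (f 1₅) tail₁
  tail₃ = m+n≡0⇒n≡0 (f 2₅) tail₂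

abstract
  -- Opaque, since over 𝔽₅⁵ it would unfold into 3125 summands; outside this block it is handled
  -- through the lemmas below.
  Σᵛ : (Vector r → ℕ) → ℕ
  Σᵛ {zero}  f = f []
  Σᵛ {suc r} f = Σ₅ λ a → Σᵛ λ v → f (a ∷ v)

  Σᵛ-cong : {f g : Vector r → ℕ} → (∀ v → f v ≡ g v) → Σᵛ f ≡ Σᵛ g
  Σᵛ-cong {zero}  eq = eq []
  Σᵛ-cong {suc r} eq = Σ₅-cong λ a → Σᵛ-cong λ v → eq (a ∷ v)

  Σᵛ-+ : (f g : Vector r → ℕ) → Σᵛ (λ v → f v + g v) ≡ Σᵛ f + Σᵛ g
  Σᵛ-+ {zero}  f g = refl
  Σᵛ-+ {suc r} f g = trans
    (Σ₅-cong λ a → Σᵛ-+ (f ∘ (a ∷_)) (g ∘ (a ∷_)))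
    (Σ₅-+ (λ a → Σᵛ (f ∘ (a ∷_))) (λ a → Σᵛ (g ∘ (a ∷_))))

  Σᵛ-0 : {f : Vector r → ℕ} → (∀ v → f v ≡ 0) → Σᵛ f ≡ 0
  Σᵛ-0 {zero}  eq = eq []
  Σᵛ-0 {suc r} eq = Σ₅-cong {g = λ _ → 0} λ a → Σᵛ-0 λ v → eq (a ∷ v)

  Σᵛ-*ˡ : ∀ c (f : Vector r → ℕ) → Σᵛ (λ v → c * f v) ≡ c * Σᵛ f
  Σᵛ-*ˡ zero    f = Σᵛ-0 {f = λ v → 0 * f v} (λ _ → refl)
  Σᵛ-*ˡ (suc c) f = trans (Σᵛ-+ f (λ v → c * f v)) (cong (Σᵛ f +_) (Σᵛ-*ˡ c f))

  Σᵛ-1 : Σᵛ {r} (λ _ → 1) ≡ 5 ^ r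
  Σᵛ-1 {zero}  = refl
  Σᵛ-1 {suc r} = trans (Σ₅-cong {g = λ _ → 5 ^ r} λ _ → Σᵛ-1 {r}) (five (5 ^ r))
    where
    five : ∀ x → x + (x + (x + (x + x))) ≡ 5 * x
    five = solve-∀

  -- Translation permutes the vectors. This replaces cosets when solution spaces are counted.
  Σᵛ-shift : ∀ (f : Vector r → ℕ) w → Σᵛ (λ v → f (w +ᵛ v)) ≡ Σᵛ f
  Σᵛ-shift f []      = refl
  Σᵛ-shift f (c ∷ w) = trans
    (Σ₅-cong λ a → Σᵛ-shift (λ v → f (c +₅ a ∷ v)) w)
    (Σ₅-shift (λ a → Σᵛ (f ∘ (a ∷_))) c)

  Σᵛ-swap : (f : 𝔽₅ → Vector r → ℕ) → Σ₅ (λ a → Σᵛ (f a)) ≡ Σᵛ (λ v → Σ₅ (λ a → f a v))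
  Σᵛ-swap {zero}  f = refl
  Σᵛ-swap {suc r} f = trans
    (Σ₅-swap (λ a b → Σᵛ (f a ∘ (b ∷_))))
    (Σ₅-cong λ b → Σᵛ-swap (λ a → f a ∘ (b ∷_)))

  Σ-Σᵛ-swap : (xs : List A) (f : A → Vector r → ℕ) → Σᵛ (λ v → Σ[ xs ] (λ x → f x v)) ≡ Σ[ xs ] (λ x → Σᵛ (f x))
  Σ-Σᵛ-swap []       f = Σᵛ-0 {f = λ v → Σ[ [] ] λ x → f x v} λ _ → refl
  Σ-Σᵛ-swap (x ∷ xs) f = trans (Σᵛ-+ (f x) _) (cong (Σᵛ (f x) +_) (Σ-Σᵛ-swap xs f))

  Σᵛ-atZero : (f : Vector r → ℕ) → (∀ v → v ≢ 0ᵛ → f v ≡ 0) → Σᵛ f ≡ f 0ᵛ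
  Σᵛ-atZero {zero}  f vanish = refl
  Σᵛ-atZero {suc r} f vanish = trans
    (cong₂ _+_ (Σᵛ-atZero (f ∘ (0₅ ∷_)) λ v v≢0 → vanish (0₅ ∷ v) (v≢0 ∘ proj₂ ∘ ∷-injective))
               (cong₂ _+_ (away 0₅) (cong₂ _+_ (away 1₅) (cong₂ _+_ (away 2₅) (away 3₅)))))
    (+-identityʳ _)
    where
    away : ∀ (i : Fin 4) → Σᵛ (f ∘ (suc i ∷_)) ≡ 0
    away i = Σᵛ-0 λ v → vanish (suc i ∷ v) λ ()

  Σᵛ-∣ : ∀ d (f : Vector r → ℕ) → (∀ v → d ∣ f v) → d ∣ Σᵛ f
  Σᵛ-∣ {zero}  d f div = div []
  Σᵛ-∣ {suc r} d f div =
    ∣m∣n⇒∣m+n (part 0₅) (∣m∣n⇒∣m+n (part 1₅) (∣m∣n⇒∣m+n (part 2₅) (∣m∣n⇒∣m+n (part 3₅) (part 4₅))))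
    where
    part : ∀ a → d ∣ Σᵛ (f ∘ (a ∷_))
    part a = Σᵛ-∣ d (f ∘ (a ∷_)) (div ∘ (a ∷_))

  Σᵛ≡0⇒≡0 : (f : Vector r → ℕ) → Σᵛ f ≡ 0 → ∀ v → f v ≡ 0
  Σᵛ≡0⇒≡0 f eq []      = eq
  Σᵛ≡0⇒≡0 f eq (a ∷ v) = Σᵛ≡0⇒≡0 (f ∘ (a ∷_)) (Σ₅≡0⇒≡0 (λ a → Σᵛ (f ∘ (a ∷_))) eq a) v

-- Exhaustive search

Searchable : Set → Set₁
Searchable A = {P : A → Set} → Decidable P → Dec (∃[ x ] P x)

vec-searchable : Searchable A → Searchable (Vec A n)
vec-searchable {n = zero}  search P? = map′ (λ p → [] , p) (λ { ([] , p) → p }) (P? [])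
vec-searchable {n = suc n} search P? =
  map′ (λ { (x , xs , p) → x ∷ xs , p }) (λ { (x ∷ xs , p) → x , xs , p })
       (search λ x → vec-searchable search λ xs → P? (x ∷ xs))

pair-searchable : Searchable A → Searchable B → Searchable (A × B)
pair-searchable searchA searchB P? =
  map′ (λ { (x , y , p) → (x , y) , p }) (λ { ((x , y) , p) → x , y , p })
       (searchA λ x → searchB λ y → P? (x , y))

abstract
  -- Opaque: it supplies witnesses constructively, and the search through 5 ^ r vectors is never
  -- run.
  vector-searchable : Searchable (Vector r)
  vector-searchable = vec-searchable any?

-- Counting the solutions of linear systems

δ : 𝔽₅ → 𝔽₅ → ℕ
δ a x = if does (a ≟ x) then 1 else 0

abstract
  Σ₅-δ : ∀ x → Σ₅ (λ a → δ a x) ≡ 1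
  Σ₅-δ = from-yes (all? λ x → Σ₅ (λ a → δ a x) ≟ℕ 1)

  -- For a vector w′ with value 1 at v, translation by `a ·ᵛ w′` adds `a` to the value at v and so
  -- carries the fibre over 0 to the fibre over `a`.
  δ-shift : ∀ a x → δ a (a *₅ 1₅ +₅ x) ≡ [ x ≡0]
  δ-shift = from-yes (all? λ a → all? λ x → δ a (a *₅ 1₅ +₅ x) ≟ℕ [ x ≡0])

  -- If y ≠ 0, exactly one `a` makes the value zero; if y = 0, the value is always x.
  pencil-weight : ∀ x y → Σ₅ (λ a → [ x +₅ a *₅ y ≢0]) ≡ 4 * [ y ≢0] + 5 * ([ y ≡0] * [ x ≢0])
  pencil-weight = from-yes (all? λ x → all? λ y →
    Σ₅ (λ a → [ x +₅ a *₅ y ≢0]) ≟ℕ 4 * [ y ≢0] + 5 * ([ y ≡0] * [ x ≢0]))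

[≡0]≡1⇒≡0 : ∀ a → [ a ≡0] ≡ 1 → a ≡ 0₅
[≡0]≡1⇒≡0 zero _ = refl

-- The indicator of the functionals u that vanish on all of `vs`, as a product so that separate
-- conditions multiply. Its sum `ν` is 5 to the power r minus the rank of `vs`, which lets counting
-- replace dimension theory.
zeros : List (Vector r) → Vector r → ℕ
zeros []       u = 1
zeros (v ∷ vs) u = [ dot u v ≡0] * zeros vs u

ν : List (Vector r) → ℕ
ν vs = Σᵛ (zeros vs)

zeros≤1 : ∀ (vs : List (Vector r)) u → zeros vs u ≤ 1
zeros≤1 []       u = ≤-refl
zeros≤1 (v ∷ vs) u = *-mono-≤ ([≡0]≤1 (dot u v)) (zeros≤1 vs u)

zeros≡1⇒All : ∀ (vs : List (Vector r)) {u} → zeros vs u ≡ 1 → All (λ v → dot u v ≡ 0₅) vs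
zeros≡1⇒All []       eq = []
zeros≡1⇒All (v ∷ vs) {u} eq =
  [≡0]≡1⇒≡0 _ (m*n≡1⇒m≡1 [ dot u v ≡0] _ eq) ∷ zeros≡1⇒All vs (m*n≡1⇒n≡1 [ dot u v ≡0] _ eq)

zeros-shift : ∀ (vs : List (Vector r)) {w} → All (λ v → dot w v ≡ 0₅) vs →
  ∀ a u → zeros vs (a ·ᵛ w +ᵛ u) ≡ zeros vs u
zeros-shift []       []           a u = refl
zeros-shift (v ∷ vs) {w} (eq ∷ eqs) a u = cong₂ (λ x y → [ x ≡0] * y) lemma (zeros-shift vs eqs a u)
  where
  lemma : dot (a ·ᵛ w +ᵛ u) v ≡ dot u v
  lemma = begin
    dot (a ·ᵛ w +ᵛ u) v        ≡⟨ dot-+ᵛˡ (a ·ᵛ w) u v ⟩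
    dot (a ·ᵛ w) v +₅ dot u v  ≡⟨ cong (_+₅ dot u v) (dot-·ᵛˡ a w v) ⟩
    a *₅ dot w v +₅ dot u v    ≡⟨ cong (λ z → a *₅ z +₅ dot u v) eq ⟩
    a *₅ 0₅ +₅ dot u v         ≡⟨ cong (_+₅ dot u v) (*₅-zeroʳ a) ⟩
    0₅ +₅ dot u v              ≡⟨ +₅-identityˡ _ ⟩
    dot u v                    ∎
    where open ≡-Reasoning

five : ∀ x → x + (x + (x + (x + x))) ≡ 5 * x
five = solve-∀

-- One more linear condition on a solution space is either redundant or splits
-- it into five translates of equal size.
ν-∷ : ∀ (v : Vector r) vs → ν (v ∷ vs) ≡ ν vs ⊎
  (5 * ν (v ∷ vs) ≡ ν vs × Σᵛ (λ u → δ 1₅ (dot u v) * zeros vs u) ≡ ν (v ∷ vs))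
ν-∷ {r} v vs with vector-searchable {r} (λ w → (zeros vs w ≟ℕ 1) ×-dec ¬? (dot w v ≟ 0₅))
... | no none = inj₁ (Σᵛ-cong λ u → redundant u (zeros≤1 vs u) refl)
  where
  redundant : ∀ u {z} → z ≤ 1 → zeros vs u ≡ z → [ dot u v ≡0] * zeros vs u ≡ zeros vs u
  redundant u {0} _ eq rewrite eq = *-zeroʳ [ dot u v ≡0]
  redundant u {1} _ eq with dot u v in duv
  ... | zero  = +-identityʳ _
  ... | suc i = contradiction (u , eq , λ d≡0 → contradiction (trans (sym duv) d≡0) λ ()) none
  redundant u {suc (suc _)} (s≤s ())
... | yes (w , zw≡1 , w·v≢0) = inj₂ (count , fiber 1₅)
  where
  scale = inverse₅ (dot w v) w·v≢0
  w′ = proj₁ scale ·ᵛ w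
  w′·v≡1 : dot w′ v ≡ 1₅
  w′·v≡1 = trans (dot-·ᵛˡ (proj₁ scale) w v) (proj₂ scale)
  shift : ∀ a u → zeros vs (a ·ᵛ w′ +ᵛ u) ≡ zeros vs u
  shift a u = trans (cong (λ z → zeros vs (z +ᵛ u)) (sym (·ᵛ-assoc a (proj₁ scale) w)))
                    (zeros-shift vs (zeros≡1⇒All vs zw≡1) (a *₅ proj₁ scale) u)
  fiber : ∀ a → Σᵛ (λ u → δ a (dot u v) * zeros vs u) ≡ ν (v ∷ vs)
  fiber a = trans (sym (Σᵛ-shift (λ u → δ a (dot u v) * zeros vs u) (a ·ᵛ w′)))
    (Σᵛ-cong λ u → cong₂ _*_
      (trans (cong (δ a) (trans (dot-+ᵛˡ (a ·ᵛ w′) u v)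
               (cong (_+₅ dot u v) (trans (dot-·ᵛˡ a w′ v) (cong (a *₅_) w′·v≡1)))))
             (δ-shift a (dot u v)))
      (shift a u))
  count : 5 * ν (v ∷ vs) ≡ ν vs
  count = begin
    5 * ν (v ∷ vs)                                          ≡⟨ five (ν (v ∷ vs)) ⟨
    Σ₅ (λ _ → ν (v ∷ vs))                                   ≡⟨ Σ₅-cong fiber ⟨
    Σ₅ (λ a → Σᵛ (λ u → δ a (dot u v) * zeros vs u))        ≡⟨ Σᵛ-swap (λ a u → δ a (dot u v) * zeros vs u) ⟩
    Σᵛ (λ u → Σ₅ (λ a → δ a (dot u v) * zeros vs u))        ≡⟨ Σᵛ-cong (λ u → collect (λ a → δ a (dot u v)) (zeros vs u)) ⟩
    Σᵛ (λ u → Σ₅ (λ a → δ a (dot u v)) * zeros vs u)        ≡⟨ Σᵛ-cong (λ u → cong (_* zeros vs u) (Σ₅-δ (dot u v))) ⟩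
    Σᵛ (λ u → 1 * zeros vs u)                               ≡⟨ Σᵛ-cong {g = zeros vs} (λ u → *-identityˡ (zeros vs u)) ⟩
    ν vs                                                    ∎
    where
    open ≡-Reasoning
    collect : ∀ (f : 𝔽₅ → ℕ) z → Σ₅ (λ a → f a * z) ≡ Σ₅ f * z
    collect f z = distrib (f 0₅) (f 1₅) (f 2₅) (f 3₅) (f 4₅) z
      where
      distrib : ∀ a b c d e z → a * z + (b * z + (c * z + (d * z + e * z))) ≡ (a + (b + (c + (d + e)))) * z
      distrib = solve-∀

ν-≤ : ∀ (v : Vector r) vs → ν vs ≤ 5 * ν (v ∷ vs)
ν-≤ v vs with ν-∷ v vs
... | inj₁ eq       = ≤-trans (≤-reflexive (sym eq)) (m≤n*m (ν (v ∷ vs)) 5)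
... | inj₂ (eq , _) = ≤-reflexive (sym eq)

-- Rank-nullity in counting form: each condition divides the number of solutions by at most 5. The
-- product avoids a subtraction in the exponent.
ν-lower : ∀ (vs : List (Vector r)) → 5 ^ r ≤ 5 ^ length vs * ν vs
ν-lower {r} []       = ≤-reflexive (sym (trans (+-identityʳ _) (Σᵛ-1 {r})))
ν-lower {r} (v ∷ vs) = begin
  5 ^ r                                ≤⟨ ν-lower vs ⟩
  5 ^ length vs * ν vs                 ≤⟨ *-monoʳ-≤ (5 ^ length vs) (ν-≤ v vs) ⟩
  5 ^ length vs * (5 * ν (v ∷ vs))     ≡⟨ *-assoc (5 ^ length vs) 5 _ ⟨
  5 ^ length vs * 5 * ν (v ∷ vs)       ≡⟨ cong (_* ν (v ∷ vs)) (*-comm (5 ^ length vs) 5) ⟩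
  5 * 5 ^ length vs * ν (v ∷ vs)       ∎
  where open ≤-Reasoning

-- If only 0 were orthogonal to `vs`, then `ν vs` would be at most 1 and `ν-lower` would give
-- `5 ^ r ≤ 5 ^ length vs`.
orthogonal-vector : ∀ (vs : List (Vector r)) → length vs < r → ∃[ u ] (u ≢ 0ᵛ × All (λ v → dot u v ≡ 0₅) vs)
orthogonal-vector {r} vs vs<r with vector-searchable {r} (λ u → ¬? (u ≟ᵛ 0ᵛ) ×-dec (zeros vs u ≟ℕ 1))
... | yes (u , u≢0 , eq) = u , u≢0 , zeros≡1⇒All vs eq
... | no none = contradiction (begin-strict
      5 ^ length vs           <⟨ ^-monoʳ-< 5 (s≤s (s≤s z≤n)) vs<r ⟩
      5 ^ r                   ≤⟨ ν-lower vs ⟩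
      5 ^ length vs * ν vs    ≤⟨ *-monoʳ-≤ (5 ^ length vs) ν≤1 ⟩
      5 ^ length vs * 1       ≡⟨ *-identityʳ _ ⟩
      5 ^ length vs           ∎) (<-irrefl refl)
  where
  open ≤-Reasoning
  ν≤1 : ν vs ≤ 1
  ν≤1 = ≤-trans (≤-reflexive (Σᵛ-atZero (zeros vs) λ u u≢0 →
    n<1⇒n≡0 (≤∧≢⇒< (zeros≤1 vs u) λ eq → none (u , u≢0 , eq)))) (zeros≤1 vs 0ᵛ)

-- Griesmer's bound

-- The sum of ⌈d/5ⁱ⌉ over i < k: `(d + 4) / 5` is ⌈d/5⌉, and iterated ceilings compose.
griesmerSum : ℕ → ℕ → ℕ
griesmerSum zero    d = 0
griesmerSum (suc k) d = d + griesmerSum k ((d + 4) / 5)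

griesmerSum-mono : ∀ k {d e} → d ≤ e → griesmerSum k d ≤ griesmerSum k e
griesmerSum-mono zero    d≤e = z≤n
griesmerSum-mono (suc k) d≤e = +-mono-≤ d≤e (griesmerSum-mono k (/-monoˡ-≤ 5 (+-monoˡ-≤ 4 d≤e)))

ceiling-≤ : ∀ {d w} → d ≤ 5 * w → (d + 4) / 5 ≤ w
ceiling-≤ {d} {w} d≤5w = s≤s⁻¹′ (m<n*o⇒m/o<n {d + 4} {suc w} {5} (begin-strict
  d + 4        <⟨ +-monoʳ-< d (n<1+n 4) ⟩
  d + 5        ≤⟨ +-monoˡ-≤ 5 d≤5w ⟩
  5 * w + 5    ≡⟨ trans (+-comm (5 * w) 5) (cong (5 +_) (*-comm 5 w)) ⟩
  5 + w * 5    ∎))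
  where
  open ≤-Reasoning
  s≤s⁻¹′ : ∀ {m n} → m < suc n → m ≤ n
  s≤s⁻¹′ (s≤s p) = p

-- A linear code as a family of functionals: u is the message, a list of elements of X gives the
-- coordinates, and `φ u x` is the entry at x. Restricting the coordinates changes only the list,
-- restricting the messages composes `φ` with a linear map.
record Linear (φ : Vector k → X → 𝔽₅) : Set where
  field
    additive    : ∀ u v x → φ (u +ᵛ v) x ≡ φ u x +₅ φ v x
    homogeneous : ∀ a u x → φ (a ·ᵛ u) x ≡ a *₅ φ u x

open Linear

weight : (Vector k → X → 𝔽₅) → List X → Vector k → ℕ
weight φ xs u = Σ[ xs ] λ x → [ φ u x ≢0]

weight≤length : ∀ (φ : Vector k → X → 𝔽₅) xs u → weight φ xs u ≤ length xs
weight≤length φ []       u = z≤n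
weight≤length φ (x ∷ xs) u = +-mono-≤ (lemma (φ u x)) (weight≤length φ xs u)
  where
  lemma : ∀ a → [ a ≢0] ≤ 1
  lemma zero    = z≤n
  lemma (suc _) = ≤-refl

kernel : (Vector k → X → 𝔽₅) → Vector k → List X → List X
kernel φ u = filter (λ x → φ u x ≟ 0₅)

length-kernel : ∀ (φ : Vector k → X → 𝔽₅) u xs → length xs ≡ weight φ xs u + length (kernel φ u xs)
length-kernel φ u [] = refl
length-kernel φ u (x ∷ xs) with φ u x
... | zero  = trans (cong suc (length-kernel φ u xs)) (sym (+-suc _ _))
... | suc _ = cong suc (length-kernel φ u xs)

weight-kernel : ∀ (φ : Vector k → X → 𝔽₅) u w xs →
  weight φ (kernel φ u xs) w ≡ Σ[ xs ] λ x → [ φ u x ≡0] * [ φ w x ≢0]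
weight-kernel φ u w [] = refl
weight-kernel φ u w (x ∷ xs) with φ u x
... | zero  = cong₂ _+_ (sym (+-identityʳ _)) (weight-kernel φ u w xs)
... | suc _ = weight-kernel φ u w xs

-- Sum `pencil-weight` over the coordinates: one in the support of the word of u is nonzero for four
-- of the five `a`; any other counts five times or not at all, according to the word of w.
pencil : ∀ {φ : Vector k → X → 𝔽₅} → Linear φ → ∀ xs u w →
  Σ₅ (λ a → weight φ xs (w +ᵛ a ·ᵛ u)) ≡ 4 * weight φ xs u + 5 * weight φ (kernel φ u xs) w
pencil {φ = φ} lin xs u w = trans (go xs) (cong (λ z → 4 * weight φ xs u + 5 * z) (sym (weight-kernel φ u w xs)))
  where
  K = λ x → [ φ u x ≡0] * [ φ w x ≢0]
  go : ∀ xs → Σ₅ (λ a → weight φ xs (w +ᵛ a ·ᵛ u)) ≡ 4 * weight φ xs u + 5 * Σ[ xs ] K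
  go []       = refl
  go (x ∷ xs) = begin
    Σ₅ (λ a → [ φ (w +ᵛ a ·ᵛ u) x ≢0] + weight φ xs (w +ᵛ a ·ᵛ u))
      ≡⟨ Σ₅-+ (λ a → [ φ (w +ᵛ a ·ᵛ u) x ≢0]) (λ a → weight φ xs (w +ᵛ a ·ᵛ u)) ⟩
    Σ₅ (λ a → [ φ (w +ᵛ a ·ᵛ u) x ≢0]) + Σ₅ (λ a → weight φ xs (w +ᵛ a ·ᵛ u))
      ≡⟨ cong₂ _+_ (Σ₅-cong λ a → cong [_≢0] (trans (additive lin w (a ·ᵛ u) x) (cong (φ w x +₅_) (homogeneous lin a u x)))) (go xs) ⟩
    Σ₅ (λ a → [ φ w x +₅ a *₅ φ u x ≢0]) + (4 * weight φ xs u + 5 * Σ[ xs ] K)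
      ≡⟨ cong (_+ (4 * weight φ xs u + 5 * Σ[ xs ] K)) (pencil-weight (φ w x) (φ u x)) ⟩
    4 * [ φ u x ≢0] + 5 * K x + (4 * weight φ xs u + 5 * Σ[ xs ] K)
      ≡⟨ regroup [ φ u x ≢0] (K x) (weight φ xs u) (Σ[ xs ] K) ⟩
    4 * weight φ (x ∷ xs) u + 5 * Σ[ x ∷ xs ] K ∎
    where
    open ≡-Reasoning
    regroup : ∀ a b c d → 4 * a + 5 * b + (4 * c + 5 * d) ≡ 4 * (a + c) + 5 * (b + d)
    regroup = solve-∀

MinWeight : (Vector k → X → 𝔽₅) → List X → ℕ → Set
MinWeight φ xs d = ∀ u → u ≢ 0ᵛ → d ≤ weight φ xs u

-- Raise d one step at a time until a nonzero message attains it; the length of the code bounds the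
-- number of steps.
minWeight-attained : ∀ (φ : Vector (suc k) → X → 𝔽₅) xs d → MinWeight φ xs d →
  ∃[ e ] (d ≤ e × MinWeight φ xs e × ∃[ u ] (u ≢ 0ᵛ × weight φ xs u ≡ e))
minWeight-attained {k} φ xs d min = climb (length xs) d (m≤m+n (length xs) d) ≤-refl min
  where
  climb : ∀ fuel e → length xs ≤ fuel + e → d ≤ e → MinWeight φ xs e →
    ∃[ e ] (d ≤ e × MinWeight φ xs e × ∃[ u ] (u ≢ 0ᵛ × weight φ xs u ≡ e))
  -- Here e is at least the length, so any nonzero message has weight exactly e.
  climb zero e len d≤e mine =
    e , d≤e , mine , 1₅ ∷ 0ᵛ , (λ ()) , ≤-antisym (≤-trans (weight≤length φ xs _) len) (mine (1₅ ∷ 0ᵛ) λ ())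
  climb (suc fuel) e len d≤e mine with vector-searchable {suc k} (λ u → ¬? (u ≟ᵛ 0ᵛ) ×-dec (weight φ xs u ≟ℕ e))
  ... | yes (u , u≢0 , eq) = e , d≤e , mine , u , u≢0 , eq
  ... | no none = climb fuel (suc e) (≤-trans len (≤-reflexive (sym (+-suc fuel e)))) (m≤n⇒m≤1+n d≤e)
                        λ u u≢0 → ≤∧≢⇒< (mine u u≢0) λ eq → none (u , u≢0 , sym eq)

nonzero-entry : ∀ (u : Vector r) → u ≢ 0ᵛ → ∃[ i ] lookup u i ≢ 0₅
nonzero-entry []      u≢0 = contradiction refl u≢0
nonzero-entry (suc a ∷ u) u≢0 = zero , λ ()
nonzero-entry (zero  ∷ u) u≢0 with nonzero-entry u (u≢0 ∘ cong (0₅ ∷_))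
... | i , ui≢0 = suc i , ui≢0

-- The vectors with entry 0 at position i form a complement of the line through any u whose entry at
-- i is nonzero; they stand for the messages modulo u.
embed : Fin (suc k) → Vector k → Vector (suc k)
embed i w = insertAt w i 0₅

embed-+ : ∀ i (u v : Vector k) → embed i (u +ᵛ v) ≡ embed i u +ᵛ embed i v
embed-+ zero    u       v       = refl
embed-+ (suc i) (a ∷ u) (b ∷ v) = cong (a +₅ b ∷_) (embed-+ i u v)

embed-· : ∀ i a (u : Vector k) → embed i (a ·ᵛ u) ≡ a ·ᵛ embed i u
embed-· zero    a u       = cong (_∷ a ·ᵛ u) (sym (*₅-zeroʳ a))
embed-· (suc i) a (b ∷ u) = cong (a *₅ b ∷_) (embed-· i a u)

-- At position i the sum is `a` times the entry of u, so its vanishing forces `a` to be 0 and then w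
-- to be 0.
embed-transverse : ∀ i {u : Vector (suc k)} → lookup u i ≢ 0₅ →
  ∀ {w} → w ≢ 0ᵛ → ∀ a → embed i w +ᵛ a ·ᵛ u ≢ 0ᵛ
embed-transverse zero {x ∷ u} x≢0 {w} w≢0 a eq = w≢0 (begin
  w              ≡⟨ +ᵛ-identityʳ w ⟨
  w +ᵛ 0ᵛ        ≡⟨ cong (w +ᵛ_) (·ᵛ-zeroˡ u) ⟨
  w +ᵛ 0₅ ·ᵛ u   ≡⟨ cong (λ b → w +ᵛ b ·ᵛ u) a≡0 ⟨
  w +ᵛ a ·ᵛ u    ≡⟨ proj₂ (∷-injective eq) ⟩
  0ᵛ             ∎)
  where
  open ≡-Reasoning
  a≡0 : a ≡ 0₅
  a≡0 = *₅-nonzero x a x≢0 (trans (*₅-comm x a) (trans (sym (+₅-identityˡ _)) (proj₁ (∷-injective eq))))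
embed-transverse (suc i) {x ∷ u} ui≢0 {y ∷ w} yw≢0 a eq with w ≟ᵛ 0ᵛ
... | no w≢0  = embed-transverse i ui≢0 w≢0 a (proj₂ (∷-injective eq))
... | yes w≡0 = yw≢0 (cong₂ _∷_ y≡0 w≡0)
  where
  0+a·u≡0 : embed i 0ᵛ +ᵛ a ·ᵛ u ≡ 0ᵛ
  0+a·u≡0 = trans (cong (λ z → embed i z +ᵛ a ·ᵛ u) (sym w≡0)) (proj₂ (∷-injective eq))
  entry : ∀ {n} (i : Fin (suc n)) (u : Vector (suc n)) → embed i 0ᵛ +ᵛ a ·ᵛ u ≡ 0ᵛ → a *₅ lookup u i ≡ 0₅
  entry zero    (x ∷ u) eq = trans (sym (+₅-identityˡ _)) (proj₁ (∷-injective eq))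
  entry {suc n} (suc i) (x ∷ u) eq = entry i u (proj₂ (∷-injective eq))
  a≡0 : a ≡ 0₅
  a≡0 = *₅-nonzero (lookup u i) a ui≢0 (trans (*₅-comm (lookup u i) a) (entry i u 0+a·u≡0))
  y≡0 : y ≡ 0₅
  y≡0 = trans (sym (+₅-identityʳ y)) (trans (cong (λ b → y +₅ b *₅ x) (sym a≡0)) (proj₁ (∷-injective eq)))

-- Induction through the residual code: take a word u of minimum weight e, keep the coordinates
-- where it vanishes, and pass to messages modulo u. The residual minimum weight is at least ⌈e/5⌉.
griesmer : ∀ (φ : Vector k → X → 𝔽₅) → Linear φ → ∀ xs d → MinWeight φ xs d → griesmerSum k d ≤ length xs
griesmer {zero}  φ lin xs d min = z≤n
griesmer {suc k} φ lin xs d min with minWeight-attained φ xs d min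
... | e , d≤e , min-e , u , u≢0 , wt≡e with nonzero-entry u u≢0
... | i , ui≢0 = begin
  griesmerSum (suc k) d                          ≤⟨ griesmerSum-mono (suc k) d≤e ⟩
  e + griesmerSum k ((e + 4) / 5)                ≤⟨ +-monoʳ-≤ e (griesmer (φ ∘ embed i) residual-linear residue ((e + 4) / 5) residual-min) ⟩
  e + length residue                             ≡⟨ cong (_+ length residue) wt≡e ⟨
  weight φ xs u + length residue                 ≡⟨ length-kernel φ u xs ⟨
  length xs                                      ∎
  where
  open ≤-Reasoning
  residue = kernel φ u xs
  residual-linear : Linear (φ ∘ embed i)
  residual-linear .additive v w x = trans (cong (λ z → φ z x) (embed-+ i v w)) (additive lin _ _ x)
  residual-linear .homogeneous a v x = trans (cong (λ z → φ z x) (embed-· i a v)) (homogeneous lin a _ x)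
  residual-min : MinWeight (φ ∘ embed i) residue ((e + 4) / 5)
  -- The five words w + a u have total weight at least 5 e, and `pencil` writes this total as 4 e
  -- plus five times the residual weight of w.
  residual-min w w≢0 = ceiling-≤ (+-cancelˡ-≤ (4 * e) e _ (begin
    4 * e + e                                        ≡⟨ +-comm (4 * e) e ⟩
    5 * e                                            ≡⟨ five e ⟨
    Σ₅ (λ _ → e)                                     ≤⟨ +-mono-≤ (big 0₅) (+-mono-≤ (big 1₅) (+-mono-≤ (big 2₅) (+-mono-≤ (big 3₅) (big 4₅)))) ⟩
    Σ₅ (λ a → weight φ xs (embed i w +ᵛ a ·ᵛ u))     ≡⟨ pencil lin xs u (embed i w) ⟩
    4 * weight φ xs u + 5 * weight φ residue (embed i w) ≡⟨ cong (λ z → 4 * z + 5 * weight φ residue (embed i w)) wt≡e ⟩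
    4 * e + 5 * weight φ residue (embed i w)         ∎))
    where
    big : ∀ a → e ≤ weight φ xs (embed i w +ᵛ a ·ᵛ u)
    big a = min-e _ (embed-transverse i ui≢0 w≢0 a)

-- Line arrangements and the codes of their points

Generators : Set
Generators = Vector 5 × Vector 5

list : Generators → List (Vector 5)
list (v , w) = v ∷ w ∷ []

-- The two generators may be dependent, so a pair describes any subspace of dimension at most 2; the
-- value is 1 exactly when u vanishes on it.
incidence : Vector 5 → Generators → ℕ
incidence u L = zeros (list L) u

count⊥ : List Generators → Vector 5 → ℕ
count⊥ ls u = Σ[ ls ] (incidence u)

Bounded : ℕ → List Generators → Set
Bounded s ls = ∀ u → u ≢ 0ᵛ → count⊥ ls u ≤ s

Arrangement : ℕ → ℕ → Set
Arrangement s n = ∃[ ls ] (length ls ≡ n × Bounded s ls)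

-- One vector for each of the six points of the projective line; dependent generators may produce
-- repetitions and 0.
points : Generators → List (Vector 5)
points (v , w) = w ∷ v +ᵛ 0₅ ·ᵛ w ∷ v +ᵛ 1₅ ·ᵛ w ∷ v +ᵛ 2₅ ·ᵛ w ∷ v +ᵛ 3₅ ·ᵛ w ∷ v +ᵛ 4₅ ·ᵛ w ∷ []

dot-linear : Linear {X = Vector r} dot
dot-linear = record { additive = dot-+ᵛˡ ; homogeneous = dot-·ᵛˡ }

abstract
  -- Unless x and y are both 0, exactly one of the six values is 0.
  six-points : ∀ x y → [ y ≢0] + Σ₅ (λ a → [ x +₅ a *₅ y ≢0]) + 5 * ([ x ≡0] * ([ y ≡0] * 1)) ≡ 5
  six-points = from-yes (all? λ x → all? λ y →
    [ y ≢0] + Σ₅ (λ a → [ x +₅ a *₅ y ≢0]) + 5 * ([ x ≡0] * ([ y ≡0] * 1)) ≟ℕ 5)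

weight-points : ∀ u L → weight dot (points L) u + 5 * incidence u L ≡ 5
weight-points u (v , w) = trans
  (cong (_+ 5 * incidence u (v , w)) (cong ([ dot u w ≢0] +_)
    (trans (assoc′ (λ a → [ dot u (v +ᵛ a ·ᵛ w) ≢0]))
      (Σ₅-cong λ a → cong [_≢0] (trans (dot-+ᵛʳ u v (a ·ᵛ w)) (cong (dot u v +₅_) (dot-·ᵛʳ u a w)))))))
  (six-points (dot u v) (dot u w))
  where
  assoc′ : ∀ (f : 𝔽₅ → ℕ) → f 0₅ + (f 1₅ + (f 2₅ + (f 3₅ + (f 4₅ + 0)))) ≡ Σ₅ f
  assoc′ f = cong (λ z → f 0₅ + (f 1₅ + (f 2₅ + (f 3₅ + z)))) (+-identityʳ (f 4₅))

weight-count⊥ : ∀ ls u → weight dot (concatMap points ls) u + 5 * count⊥ ls u ≡ 5 * length ls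
weight-count⊥ []       u = refl
weight-count⊥ (L ∷ ls) u = begin
  weight dot (points L ++ concatMap points ls) u + 5 * (incidence u L + count⊥ ls u)
    ≡⟨ cong (_+ 5 * (incidence u L + count⊥ ls u)) (Σ-++ (points L) (concatMap points ls) (λ x → [ dot u x ≢0])) ⟩
  weight dot (points L) u + weight dot (concatMap points ls) u + 5 * (incidence u L + count⊥ ls u)
    ≡⟨ regroup (weight dot (points L) u) (weight dot (concatMap points ls) u) (incidence u L) (count⊥ ls u) ⟩
  weight dot (points L) u + 5 * incidence u L + (weight dot (concatMap points ls) u + 5 * count⊥ ls u)
    ≡⟨ cong₂ _+_ (weight-points u L) (weight-count⊥ ls u) ⟩
  5 + 5 * length ls
    ≡⟨ *-suc 5 (length ls) ⟨
  5 * length (L ∷ ls) ∎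
  where
  open ≡-Reasoning
  regroup : ∀ a b c d → a + b + 5 * (c + d) ≡ a + 5 * c + (b + 5 * d)
  regroup = solve-∀

length-points : ∀ ls → length (concatMap points ls) ≡ 6 * length ls
length-points []       = refl
length-points (L ∷ ls) = trans (cong (6 +_) (length-points ls)) (sym (*-suc 6 (length ls)))

griesmer-bound : Arrangement s n → griesmerSum 5 (5 * (n ∸ s)) ≤ 6 * n
griesmer-bound {s} (ls , refl , bounded) = ≤-trans
  (griesmer dot dot-linear (concatMap points ls) (5 * (length ls ∸ s)) λ u u≢0 → begin
    5 * (length ls ∸ s)                           ≡⟨ *-distribˡ-∸ 5 (length ls) s ⟩
    5 * length ls ∸ 5 * s                         ≤⟨ ∸-monoʳ-≤ (5 * length ls) (*-monoʳ-≤ 5 (bounded u u≢0)) ⟩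
    5 * length ls ∸ 5 * count⊥ ls u               ≡⟨ cong (_∸ 5 * count⊥ ls u) (weight-count⊥ ls u) ⟨
    weight dot (concatMap points ls) u + 5 * count⊥ ls u ∸ 5 * count⊥ ls u ≡⟨ m+n∸n≡m _ (5 * count⊥ ls u) ⟩
    weight dot (concatMap points ls) u            ∎)
  (≤-reflexive (length-points ls))
  where open ≤-Reasoning

-- The cases s = 2, 3, 4

-- Functionals are counted including 0: `joint L L′` is 5 to the power 5 - dim (L + L′), and
-- `size L` is 5 to the power 5 - dim L. Thus `size` is 125 for a genuine line and `joint` is 5 for
-- two skew lines.
joint : Generators → Generators → ℕ
joint L L′ = Σᵛ λ u → incidence u L * incidence u L′

size : Generators → ℕ
size L = ν (list L)

zeros-++ : ∀ (vs ws : List (Vector r)) u → zeros (vs ++ ws) u ≡ zeros vs u * zeros ws u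
zeros-++ []       ws u = sym (*-identityˡ _)
zeros-++ (v ∷ vs) ws u = trans (cong ([ dot u v ≡0] *_) (zeros-++ vs ws u)) (sym (*-assoc [ dot u v ≡0] _ _))

joint-ν : ∀ L L′ → joint L L′ ≡ ν (list L′ ++ list L)
joint-ν L L′ = Σᵛ-cong λ u → trans (*-comm (incidence u L) _) (sym (zeros-++ (list L′) (list L) u))

-- Two further conditions divide the number of solutions by at most 25.
size≤joint : ∀ L L′ → size L ≤ 25 * joint L L′
size≤joint L L′@(v , w) = begin
  size L                             ≤⟨ ν-≤ w (list L) ⟩
  5 * ν (w ∷ list L)                 ≤⟨ *-monoʳ-≤ 5 (ν-≤ v (w ∷ list L)) ⟩
  5 * (5 * ν (v ∷ w ∷ list L))       ≡⟨ *-assoc 5 5 (ν (v ∷ w ∷ list L)) ⟨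
  25 * ν (v ∷ w ∷ list L)            ≡⟨ cong (25 *_) (joint-ν L L′) ⟨
  25 * joint L L′                    ∎
  where open ≤-Reasoning

125≤size : ∀ L → 125 ≤ size L
125≤size L = *-cancelˡ-≤ 25 (ν-lower (list L))

incidence-idem : ∀ u L → incidence u L * incidence u L ≡ incidence u L
incidence-idem u L = idem (zeros≤1 (list L) u)
  where
  idem : ∀ {z} → z ≤ 1 → z * z ≡ z
  idem {0} _ = refl
  idem {1} _ = refl
  idem {suc (suc _)} (s≤s ())

joint-self : ∀ L → joint L L ≡ size L
joint-self L = Σᵛ-cong λ u → incidence-idem u L

incidence-0ᵛ : ∀ L → incidence 0ᵛ L ≡ 1
incidence-0ᵛ (v , w) rewrite dot-0ᵛˡ v | dot-0ᵛˡ w = refl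

count⊥-0ᵛ : ∀ ls → count⊥ ls 0ᵛ ≡ length ls
count⊥-0ᵛ []       = refl
count⊥-0ᵛ (L ∷ ls) = cong₂ _+_ (incidence-0ᵛ L) (count⊥-0ᵛ ls)

Σ-≥ : ∀ {A : Set} (xs : List A) {f : A → ℕ} {a} → (∀ x → a ≤ f x) → length xs * a ≤ Σ[ xs ] f
Σ-≥ []       le = z≤n
Σ-≥ (x ∷ xs) le = +-mono-≤ (le x) (Σ-≥ xs le)

Σ-≥-∈ : ∀ {A : Set} {xs : List A} {f : A → ℕ} {a e y} → (∀ x → a ≤ f x) → y ∈ xs → f y ≡ a + e →
  length xs * a + e ≤ Σ[ xs ] f
Σ-≥-∈ {xs = x ∷ xs} {f} {a} {e} le (here refl) eq = begin
  a + length xs * a + e      ≡⟨ swap a (length xs * a) e ⟩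
  a + e + length xs * a      ≤⟨ +-mono-≤ (≤-reflexive (sym eq)) (Σ-≥ xs le) ⟩
  f x + Σ[ xs ] f            ∎
  where
  open ≤-Reasoning
  swap : ∀ a b e → a + b + e ≡ a + e + b
  swap = solve-∀
Σ-≥-∈ {xs = x ∷ xs} {f} {a} {e} le (there y∈) eq =
  ≤-trans (≤-reflexive (+-assoc a (length xs * a) e)) (+-mono-≤ (le x) (Σ-≥-∈ le y∈ eq))

Σ-tight : ∀ {A : Set} (xs : List A) {f : A → ℕ} {a} → (∀ x → a ≤ f x) → Σ[ xs ] f ≤ length xs * a →
  ∀ {x} → x ∈ xs → f x ≡ a
Σ-tight (x ∷ xs) {f} {a} le tight (here refl) =
  ≤-antisym (+-cancelʳ-≤ (length xs * a) (f x) a (≤-trans (+-monoʳ-≤ (f x) (Σ-≥ xs le)) tight)) (le x)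
Σ-tight (x ∷ xs) {f} {a} le tight (there y∈) =
  Σ-tight xs le (+-cancelˡ-≤ a _ _ (≤-trans (+-monoˡ-≤ _ (le x)) tight)) y∈

Σ-const : ∀ {A : Set} (xs : List A) {f : A → ℕ} {a} → (∀ {x} → x ∈ xs → f x ≡ a) → Σ[ xs ] f ≡ length xs * a
Σ-const []       eq = refl
Σ-const (x ∷ xs) eq = cong₂ _+_ (eq (here refl)) (Σ-const xs (eq ∘ there))

count⊥-positive : ∀ ls u → count⊥ ls u ≡ 0 ⊎ (∃[ L ] (L ∈ ls × incidence u L ≡ 1))
count⊥-positive []       u = inj₁ refl
count⊥-positive (L ∷ ls) u with incidence u L in eq | zeros≤1 (list L) u
... | 1 | _ = inj₂ (L , here refl , eq)
... | 0 | _ with count⊥-positive ls u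
...   | inj₁ z = inj₁ z
...   | inj₂ (L′ , L′∈ , one) = inj₂ (L′ , there L′∈ , one)
count⊥-positive (L ∷ ls) u | suc (suc _) | s≤s ()

-- Here s is `suc σ`, and the length is one more than the bound 31 σ to be proved. For a fixed L,
-- pairs are counted of a functional vanishing on L and a line on which it also vanishes.
module Tight {σ} (1≤σ : 1 ≤ σ) (ls : List Generators) (len : length ls ≡ 31 * σ + 1) (bounded : Bounded (suc σ) ls) where

  -- How many lines the hyperplane of u lacks to reach s, if it contains L. The functional 0 defines
  -- no hyperplane and is accounted for by `atZero`.
  slack : Generators → Vector 5 → ℕ
  slack L u with u ≟ᵛ 0ᵛ
  ... | yes _ = 0
  ... | no  _ = incidence u L * (suc σ ∸ count⊥ ls u)

  slack-nonzero : ∀ L {u} → u ≢ 0ᵛ → slack L u ≡ incidence u L * (suc σ ∸ count⊥ ls u)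
  slack-nonzero L {u} u≢0 with u ≟ᵛ 0ᵛ
  ... | yes u≡0 = contradiction u≡0 u≢0
  ... | no _    = refl

  atZero : Vector 5 → ℕ
  atZero u with u ≟ᵛ 0ᵛ
  ... | yes _ = 1
  ... | no  _ = 0

  Σ-atZero : Σᵛ atZero ≡ 1
  Σ-atZero = Σᵛ-atZero atZero vanish
    where
    vanish : ∀ u → u ≢ 0ᵛ → atZero u ≡ 0
    vanish u u≢0 with u ≟ᵛ 0ᵛ
    ... | yes u≡0 = contradiction u≡0 u≢0
    ... | no _    = refl

  -- The count and the deficit of a hyperplane add up to `suc σ`, whereas 0 annihilates all 31 σ + 1
  -- lines, which exceeds `suc σ` by 30 σ.
  slack-eq : ∀ L u → incidence u L * count⊥ ls u + slack L u ≡ suc σ * incidence u L + 30 * σ * atZero u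
  slack-eq L u with u ≟ᵛ 0ᵛ
  ... | yes refl rewrite incidence-0ᵛ L | count⊥-0ᵛ ls | len = arith σ
    where
    arith : ∀ σ → 1 * (31 * σ + 1) + 0 ≡ suc σ * 1 + 30 * σ * 1
    arith = solve-∀
  ... | no u≢0 = begin
    incidence u L * count⊥ ls u + incidence u L * (suc σ ∸ count⊥ ls u) ≡⟨ *-distribˡ-+ (incidence u L) (count⊥ ls u) _ ⟨
    incidence u L * (count⊥ ls u + (suc σ ∸ count⊥ ls u))               ≡⟨ cong (incidence u L *_) (m+[n∸m]≡n (bounded u u≢0)) ⟩
    incidence u L * suc σ                                               ≡⟨ arith (incidence u L) σ ⟩
    suc σ * incidence u L + 30 * σ * 0                                  ∎
    where
    open ≡-Reasoning
    arith : ∀ x σ → x * suc σ ≡ suc σ * x + 30 * σ * 0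
    arith = solve-∀

  Σ-joint : ∀ L → Σ[ ls ] (joint L) ≡ Σᵛ (λ u → incidence u L * count⊥ ls u)
  Σ-joint L = trans (sym (Σ-Σᵛ-swap ls (λ L′ u → incidence u L * incidence u L′)))
                    (Σᵛ-cong λ u → Σ-*ˡ (incidence u L) ls (incidence u))

  balance : ∀ L → Σ[ ls ] (joint L) + Σᵛ (slack L) ≡ suc σ * size L + 30 * σ
  balance L = begin
    Σ[ ls ] (joint L) + Σᵛ (slack L)                            ≡⟨ cong (_+ Σᵛ (slack L)) (Σ-joint L) ⟩
    Σᵛ (λ u → incidence u L * count⊥ ls u) + Σᵛ (slack L)       ≡⟨ Σᵛ-+ (λ u → incidence u L * count⊥ ls u) (slack L) ⟨
    Σᵛ (λ u → incidence u L * count⊥ ls u + slack L u)          ≡⟨ Σᵛ-cong (slack-eq L) ⟩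
    Σᵛ (λ u → suc σ * incidence u L + 30 * σ * atZero u)        ≡⟨ Σᵛ-+ (λ u → suc σ * incidence u L) (λ u → 30 * σ * atZero u) ⟩
    Σᵛ (λ u → suc σ * incidence u L) + Σᵛ (λ u → 30 * σ * atZero u)
      ≡⟨ cong₂ _+_ (Σᵛ-*ˡ (suc σ) (λ u → incidence u L)) (trans (Σᵛ-*ˡ (30 * σ) atZero) (trans (cong (30 * σ *_) Σ-atZero) (*-identityʳ _))) ⟩
    suc σ * size L + 30 * σ                                     ∎
    where open ≡-Reasoning

  -- Bound the left side of `balance` from below: `25 * joint L L′` is at least `size L` for every
  -- L′, and for L itself it exceeds this by `24 * size L`.
  key : ∀ {L} → L ∈ ls → 6 * σ * size L + 25 * Σᵛ (slack L) ≤ 750 * σ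
  key {L} L∈ = +-cancelˡ-≤ (25 * suc σ * size L) _ _ (begin
    25 * suc σ * size L + (6 * σ * size L + 25 * Σᵛ (slack L))
      ≡⟨ arith₁ σ (size L) (Σᵛ (slack L)) ⟩
    (31 * σ + 1) * size L + 24 * size L + 25 * Σᵛ (slack L)
      ≡⟨ cong (λ z → z * size L + 24 * size L + 25 * Σᵛ (slack L)) len ⟨
    length ls * size L + 24 * size L + 25 * Σᵛ (slack L)
      ≤⟨ +-monoˡ-≤ (25 * Σᵛ (slack L)) (Σ-≥-∈ (size≤joint L) L∈ (trans (cong (25 *_) (joint-self L)) (arith₂ (size L)))) ⟩
    Σ[ ls ] (λ L′ → 25 * joint L L′) + 25 * Σᵛ (slack L)
      ≡⟨ cong (_+ 25 * Σᵛ (slack L)) (Σ-*ˡ 25 ls (joint L)) ⟩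
    25 * Σ[ ls ] (joint L) + 25 * Σᵛ (slack L)
      ≡⟨ *-distribˡ-+ 25 (Σ[ ls ] (joint L)) _ ⟨
    25 * (Σ[ ls ] (joint L) + Σᵛ (slack L))
      ≡⟨ cong (25 *_) (balance L) ⟩
    25 * (suc σ * size L + 30 * σ)
      ≡⟨ arith₃ σ (size L) ⟩
    25 * suc σ * size L + 750 * σ ∎)
    where
    open ≤-Reasoning
    arith₁ : ∀ σ q D → 25 * suc σ * q + (6 * σ * q + 25 * D) ≡ (31 * σ + 1) * q + 24 * q + 25 * D
    arith₁ = solve-∀
    arith₂ : ∀ q → 25 * q ≡ q + 24 * q
    arith₂ = solve-∀
    arith₃ : ∀ σ q → 25 * (suc σ * q + 30 * σ) ≡ 25 * suc σ * q + 750 * σ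
    arith₃ = solve-∀

  six : ∀ σ → 6 * σ * 125 ≡ 750 * σ
  six = solve-∀

  -- Since `size L` is at least 125 and 6 · 125 = 750, equality holds in `key`: there is no slack,
  -- and L is a genuine line.
  slack≡0 : ∀ {L} → L ∈ ls → Σᵛ (slack L) ≡ 0
  slack≡0 {L} L∈ = n≤0⇒n≡0 (*-cancelˡ-≤ {Σᵛ (slack L)} {0} 25 (+-cancelˡ-≤ (750 * σ) (25 * Σᵛ (slack L)) 0 (begin
    750 * σ + 25 * Σᵛ (slack L)           ≡⟨ cong (_+ 25 * Σᵛ (slack L)) (six σ) ⟨
    6 * σ * 125 + 25 * Σᵛ (slack L)       ≤⟨ +-monoˡ-≤ _ (*-monoʳ-≤ (6 * σ) (125≤size L)) ⟩
    6 * σ * size L + 25 * Σᵛ (slack L)    ≤⟨ key L∈ ⟩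
    750 * σ                               ≡⟨ +-identityʳ _ ⟨
    750 * σ + 0                           ∎)))
    where open ≤-Reasoning

  size≡125 : ∀ {L} → L ∈ ls → size L ≡ 125
  size≡125 {L} L∈ = ≤-antisym (cancel σ (size L) 125 1≤σ (begin
      6 * σ * size L                        ≤⟨ m≤m+n _ _ ⟩
      6 * σ * size L + 25 * Σᵛ (slack L)    ≤⟨ key L∈ ⟩
      750 * σ                               ≡⟨ six σ ⟨
      6 * σ * 125                           ∎)) (125≤size L)
    where
    open ≤-Reasoning
    cancel : ∀ σ a b → 1 ≤ σ → 6 * σ * a ≤ 6 * σ * b → a ≤ b
    cancel (suc σ) a b _ le = *-cancelˡ-≤ {a} {b} (6 * suc σ) le

  -- A hyperplane containing a line of the arrangement has no slack, so its count is exactly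
  -- `suc σ`; any other count is 0. Divisibility is the form that survives summation.
  count⊥-twoValued : ∀ u → u ≢ 0ᵛ → suc σ ∣ count⊥ ls u
  count⊥-twoValued u u≢0 with count⊥-positive ls u
  ... | inj₁ z = subst (suc σ ∣_) (sym z) (suc σ ∣0)
  ... | inj₂ (L , L∈ , one) = subst (suc σ ∣_) (≤-antisym (m∸n≡0⇒m≤n diff) (bounded u u≢0)) ∣-refl
    where
    diff : suc σ ∸ count⊥ ls u ≡ 0
    diff = begin
      suc σ ∸ count⊥ ls u                      ≡⟨ *-identityˡ _ ⟨
      1 * (suc σ ∸ count⊥ ls u)                ≡⟨ cong (_* (suc σ ∸ count⊥ ls u)) one ⟨
      incidence u L * (suc σ ∸ count⊥ ls u)    ≡⟨ slack-nonzero L u≢0 ⟨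
      slack L u                                ≡⟨ Σᵛ≡0⇒≡0 (slack L) (slack≡0 L∈) u ⟩
      0                                        ∎
      where open ≡-Reasoning

module Pencil {σ} (1≤σ : 1 ≤ σ) (P P′ : Vector 5) (ls′ : List Generators) (len : length ((P , P′) ∷ ls′) ≡ 31 * σ + 1)
  (bounded : Bounded (suc σ) ((P , P′) ∷ ls′)) where

  L : Generators
  L = P , P′

  ls : List Generators
  ls = L ∷ ls′

  open Tight 1≤σ ls len bounded

  len′ : length ls′ ≡ 31 * σ
  len′ = suc-injective (trans len (+-comm (31 * σ) 1))

  weighted : Vector 5 → ℕ
  weighted u = δ 1₅ (dot u P) * count⊥ ls u

  divides-weighted : ∀ u → suc σ ∣ weighted u
  divides-weighted u with u ≟ᵛ 0ᵛ
  ... | no u≢0 = ∣n⇒∣m*n (δ 1₅ (dot u P)) (count⊥-twoValued u u≢0)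
  -- The functional 0 takes the value 0 at P, not 1, so its large count drops out.
  ... | yes u≡0 = subst (suc σ ∣_) (sym (cong (λ z → δ 1₅ z * count⊥ ls u) (trans (cong (λ z → dot z P) u≡0) (dot-0ᵛˡ P)))) (suc σ ∣0)

  joint-total : Σ[ ls′ ] (joint L) ≡ length ls′ * 5
  joint-total = +-cancelˡ-≡ 125 (Σ[ ls′ ] (joint L)) (length ls′ * 5) (begin
    125 + Σ[ ls′ ] (joint L)                ≡⟨ cong (_+ Σ[ ls′ ] (joint L)) (trans (joint-self L) (size≡125 (here refl))) ⟨
    Σ[ ls ] (joint L)                       ≡⟨ +-identityʳ _ ⟨
    Σ[ ls ] (joint L) + 0                   ≡⟨ cong (Σ[ ls ] (joint L) +_) (slack≡0 (here refl)) ⟨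
    Σ[ ls ] (joint L) + Σᵛ (slack L)        ≡⟨ balance L ⟩
    suc σ * size L + 30 * σ                 ≡⟨ cong (λ z → suc σ * z + 30 * σ) (size≡125 (here refl)) ⟩
    suc σ * 125 + 30 * σ                    ≡⟨ arith σ ⟩
    125 + 31 * σ * 5                        ≡⟨ cong (λ z → 125 + z * 5) len′ ⟨
    125 + length ls′ * 5                    ∎)
    where
    open ≡-Reasoning
    arith : ∀ σ → suc σ * 125 + 30 * σ ≡ 125 + 31 * σ * 5
    arith = solve-∀

  5≤joint : ∀ L′ → 5 ≤ joint L L′
  5≤joint L′ = *-cancelˡ-≤ {5} {joint L L′} 25 (≤-trans (125≤size L) (size≤joint L L′))

  -- By `joint-total` the average is 5, and no term is smaller; so every other line is skew to L.
  joint-tight : ∀ {L′} → L′ ∈ ls′ → joint L L′ ≡ 5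
  joint-tight = Σ-tight ls′ {joint L} {5} 5≤joint (≤-reflexive joint-total)

  joint-reorder : ∀ L′ → ν (P′ ∷ P ∷ list L′) ≡ joint L L′
  joint-reorder L′ = Σᵛ-cong λ u → swap [ dot u P′ ≡0] [ dot u P ≡0] (incidence u L′)
    where
    swap : ∀ a b c → a * (b * c) ≡ b * (a * 1) * c
    swap = solve-∀

  -- If P lay on L′, at least 25 functionals would vanish on both lines.
  not-redundant : ∀ {L′} → L′ ∈ ls′ → ν (P ∷ list L′) ≢ ν (list L′)
  not-redundant {L′} L′∈ redundant = contradiction (begin
    125                             ≡⟨ size≡125 (there L′∈) ⟨
    size L′                         ≡⟨ redundant ⟨
    ν (P ∷ list L′)                 ≤⟨ ν-≤ P′ (P ∷ list L′) ⟩
    5 * ν (P′ ∷ P ∷ list L′)        ≡⟨ cong (5 *_) (trans (joint-reorder L′) (joint-tight L′∈)) ⟩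
    25                              ∎) (from-no (125 ≤? 25))
    where open ≤-Reasoning

  -- The functionals equal to 1 at a point P of the first line L form an affine
  -- space avoiding L; every other line is annihilated by 25 of them.
  fiber : ∀ {L′} → L′ ∈ ls′ → Σᵛ (λ u → δ 1₅ (dot u P) * incidence u L′) ≡ 25
  fiber {L′} L′∈ = [ (λ redundant → contradiction redundant (not-redundant L′∈)) , (λ { (count , eq) → trans eq (quotient count) }) ]′ (ν-∷ P (list L′))
    where
    quotient : 5 * ν (P ∷ list L′) ≡ size L′ → ν (P ∷ list L′) ≡ 25
    quotient count = *-cancelˡ-≡ (ν (P ∷ list L′)) 25 5 (trans count (size≡125 (there L′∈)))

  avoids : ∀ u → δ 1₅ (dot u P) * incidence u L ≡ 0
  avoids u with dot u P
  ... | 0₅ = refl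
  ... | 1₅ = refl
  ... | 2₅ = refl
  ... | 3₅ = refl
  ... | 4₅ = refl

  total : Σᵛ weighted ≡ 775 * σ
  total = begin
    Σᵛ weighted                                                      ≡⟨ Σᵛ-cong (λ u → Σ-*ˡ (δ 1₅ (dot u P)) ls (incidence u)) ⟨
    Σᵛ (λ u → Σ[ ls ] (λ L′ → δ 1₅ (dot u P) * incidence u L′))      ≡⟨ Σ-Σᵛ-swap ls (λ L′ u → δ 1₅ (dot u P) * incidence u L′) ⟩
    Σ[ ls ] (λ L′ → Σᵛ (λ u → δ 1₅ (dot u P) * incidence u L′))      ≡⟨ cong₂ _+_ (Σᵛ-0 avoids) (Σ-const ls′ fiber) ⟩
    length ls′ * 25                                                  ≡⟨ cong (_* 25) len′ ⟩
    31 * σ * 25                                                      ≡⟨ arith σ ⟩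
    775 * σ                                                          ∎
    where
    open ≡-Reasoning
    arith : ∀ σ → 31 * σ * 25 ≡ 775 * σ
    arith = solve-∀

  divisibility : suc σ ∣ 775 * σ
  divisibility = subst (suc σ ∣_) total (Σᵛ-∣ (suc σ) weighted divides-weighted)

-- As `suc σ` is coprime to `σ`, the divisibility hypothesis says that `suc σ` does not divide 775 =
-- 25 · 31.
no-tight-arrangement : ∀ σ → 1 ≤ σ → ¬ suc σ ∣ 775 * σ → ¬ Arrangement (suc σ) (31 * σ + 1)
no-tight-arrangement σ 1≤σ ∤ ([] , eq , _) = contradiction (trans eq (+-comm (31 * σ) 1)) λ ()
no-tight-arrangement σ 1≤σ ∤ ((P , P′) ∷ ls′ , eq , bounded) = ∤ (Pencil.divisibility 1≤σ P P′ ls′ eq bounded)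

-- Projective systems as lists of generators

linearCombination-+ : ∀ (cs ds : Vector k) (vs : Vec (Vector r) k) →
  linearCombination (cs +ᵛ ds) vs ≡ linearCombination cs vs +ᵛ linearCombination ds vs
linearCombination-+ []       []       []       = sym (+ᵛ-identityˡ 0ᵛ)
linearCombination-+ (c ∷ cs) (d ∷ ds) (v ∷ vs) = trans
  (cong₂ _+ᵛ_ (·ᵛ-distribʳ c d v) (linearCombination-+ cs ds vs))
  (+ᵛ-interchange (c ·ᵛ v) (d ·ᵛ v) _ _)

linearCombination-· : ∀ a (cs : Vector k) (vs : Vec (Vector r) k) →
  linearCombination (a ·ᵛ cs) vs ≡ a ·ᵛ linearCombination cs vs
linearCombination-· a []       []       = sym (·ᵛ-zeroʳ a)
linearCombination-· a (c ∷ cs) (v ∷ vs) = trans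
  (cong₂ _+ᵛ_ (·ᵛ-assoc a c v) (linearCombination-· a cs vs))
  (sym (·ᵛ-distribˡ a (c ·ᵛ v) _))

linearCombination-0 : ∀ (vs : Vec (Vector r) k) → linearCombination 0ᵛ vs ≡ 0ᵛ
linearCombination-0 []       = refl
linearCombination-0 (v ∷ vs) = trans (cong₂ _+ᵛ_ (·ᵛ-zeroˡ v) (linearCombination-0 vs)) (+ᵛ-identityˡ 0ᵛ)

dot-linearCombination : ∀ (u : Vector r) cs (vs : Vec (Vector r) k) → VecAll.All (λ v → dot u v ≡ 0₅) vs →
  dot u (linearCombination cs vs) ≡ 0₅
dot-linearCombination u []       []       VecAll.[]         = dot-0ᵛʳ u
dot-linearCombination u (c ∷ cs) (v ∷ vs) (eq VecAll.∷ eqs) = begin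
  dot u (c ·ᵛ v +ᵛ linearCombination cs vs)          ≡⟨ dot-+ᵛʳ u (c ·ᵛ v) _ ⟩
  dot u (c ·ᵛ v) +₅ dot u (linearCombination cs vs)  ≡⟨ cong₂ _+₅_ (trans (dot-·ᵛʳ u c v) (cong (c *₅_) eq)) (dot-linearCombination u cs vs eqs) ⟩
  c *₅ 0₅ +₅ 0₅                                      ≡⟨ +₅-identityʳ _ ⟩
  c *₅ 0₅                                            ≡⟨ *₅-zeroʳ c ⟩
  0₅                                                 ∎
  where open ≡-Reasoning

span : Vec (Vector r) k → Subspace r
span vs .Carrier x           = ∃[ cs ] linearCombination cs vs ≡ x
span vs .carrier? x          = vector-searchable λ cs → linearCombination cs vs ≟ᵛ x
span vs .0-closed            = 0ᵛ , linearCombination-0 vs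
span vs .+-closed (cs , eq) (ds , eq′) = cs +ᵛ ds , trans (linearCombination-+ cs ds vs) (cong₂ _+ᵛ_ eq eq′)
span vs .·-closed a (cs , eq) = a ·ᵛ cs , trans (linearCombination-· a cs vs) (cong (a ·ᵛ_) eq)

span-∷ : ∀ (v : Vector r) {vs : Vec (Vector r) k} {x} → Carrier (span vs) x → Carrier (span (v ∷ vs)) x
span-∷ v (cs , eq) = 0₅ ∷ cs , trans (cong₂ _+ᵛ_ (·ᵛ-zeroˡ v) eq) (+ᵛ-identityˡ _)

span-head : ∀ (v : Vector r) (vs : Vec (Vector r) k) → Carrier (span (v ∷ vs)) v
span-head v vs = 1₅ ∷ 0ᵛ , trans (cong₂ _+ᵛ_ (·ᵛ-identity v) (linearCombination-0 vs)) (+ᵛ-identityʳ v)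

span-members : ∀ (vs : Vec (Vector r) k) → VecAll.All (Carrier (span vs)) vs
span-members []       = VecAll.[]
span-members (v ∷ vs) = span-head v vs VecAll.∷ VecAll.map (λ {x} → span-∷ v {x = x}) (span-members vs)

-- Multiplication by 4 is negation in 𝔽₅.
cancel-sum : ∀ (x y : Vector r) → x +ᵛ y ≡ 0ᵛ → 4₅ ·ᵛ y ≡ x
cancel-sum []      []      _  = refl
cancel-sum (a ∷ x) (b ∷ y) eq =
  cong₂ _∷_ (lemma a b (proj₁ (∷-injective eq))) (cancel-sum x y (proj₂ (∷-injective eq)))
  where
  lemma : ∀ a b → a +₅ b ≡ 0₅ → 4₅ *₅ b ≡ a
  lemma = from-yes (all? λ a → all? λ b → (a +₅ b ≟ 0₅) →-dec (4₅ *₅ b ≟ a))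

-- Build a basis from the last vector backwards: a vector in the span of the later ones is dropped,
-- any other extends the basis.
span-dimension : ∀ (vs : Vec (Vector r) k) → ∃[ d ] (d ≤ k × HasDimension (span vs) d)
span-dimension []       = 0 , z≤n , [] , record { members = VecAll.[] ; independent = λ { [] _ → refl } ; spanning = id }
span-dimension (v ∷ vs) with carrier? (span vs) v | span-dimension vs
... | yes (ds , lc≡v) | d , d≤k , bs , basis = d , m≤n⇒m≤1+n d≤k , bs , record
  { members = VecAll.map (λ {x} → span-∷ v {x = x}) (members basis)
  ; independent = independent basis
  ; spanning = λ { (c ∷ cs , eq) → spanning basis
      (c ·ᵛ ds +ᵛ cs , trans (linearCombination-+ (c ·ᵛ ds) cs vs)
        (trans (cong (_+ᵛ linearCombination cs vs) (trans (linearCombination-· c ds vs) (cong (c ·ᵛ_) lc≡v))) eq)) } }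
... | no v∉ | d , d≤k , bs , basis = suc d , s≤s d≤k , v ∷ bs , record
  { members = span-head v vs VecAll.∷ VecAll.map (λ {x} → span-∷ v {x = x}) (members basis)
  ; independent = indep
  ; spanning = λ { (c ∷ cs , eq) → let es , eq′ = spanning basis (cs , refl)
                                   in c ∷ es , trans (cong (c ·ᵛ v +ᵛ_) eq′) eq } }
  where
  inSpan : ∀ (cs : Vector d) → Carrier (span vs) (linearCombination cs bs)
  inSpan cs = closed cs bs (members basis)
    where
    closed : ∀ {k} (cs : Vector k) ws → VecAll.All (Carrier (span vs)) ws → Carrier (span vs) (linearCombination cs ws)
    closed []       []       VecAll.[]         = 0-closed (span vs)
    closed (c ∷ cs) (w ∷ ws) (w∈ VecAll.∷ ws∈) = +-closed (span vs) (·-closed (span vs) c w∈) (closed cs ws ws∈)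
  indep : LinearlyIndependent (v ∷ bs)
  indep (c ∷ cs) eq with c ≟ 0₅
  ... | yes refl = cong (0₅ ∷_) (independent basis cs (trans (sym (+ᵛ-identityˡ _))
                     (trans (cong (_+ᵛ linearCombination cs bs) (sym (·ᵛ-zeroˡ v))) eq)))
  -- A relation with c ≠ 0 would express v as -c⁻¹ times an element of the span.
  ... | no c≢0 = contradiction (subst (Carrier (span vs)) unscale
                   (·-closed (span vs) b (·-closed (span vs) 4₅ (inSpan cs)))) v∉
    where
    b = proj₁ (inverse₅ c c≢0)
    unscale : b ·ᵛ (4₅ ·ᵛ linearCombination cs bs) ≡ v
    unscale = begin
      b ·ᵛ (4₅ ·ᵛ linearCombination cs bs)  ≡⟨ cong (b ·ᵛ_) (cancel-sum _ _ eq) ⟩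
      b ·ᵛ (c ·ᵛ v)                         ≡⟨ ·ᵛ-assoc b c v ⟨
      (b *₅ c) ·ᵛ v                         ≡⟨ cong (_·ᵛ v) (proj₂ (inverse₅ c c≢0)) ⟩
      1₅ ·ᵛ v                               ≡⟨ ·ᵛ-identity v ⟩
      v                                     ∎
      where open ≡-Reasoning

-- Hyperplanes as orthogonal complements

orthogonal : Vector r → Subspace r
orthogonal u .Carrier x  = dot u x ≡ 0₅
orthogonal u .carrier? x = dot u x ≟ 0₅
orthogonal u .0-closed   = dot-0ᵛʳ u
orthogonal u .+-closed {x} {y} eq eq′ = trans (dot-+ᵛʳ u x y) (cong₂ _+₅_ eq eq′)
orthogonal u .·-closed a {x} eq = trans (dot-·ᵛʳ u a x) (trans (cong (a *₅_) eq) (*₅-zeroʳ a))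

-- A linear bijection from 𝔽₅ᵏ onto the kernel of `dot u`; it carries the standard basis to a basis
-- of this kernel.
record Parametrisation (u : Vector r) (k : ℕ) : Set where
  field
    ψ           : Vector k → Vector r
    ψ-+         : ∀ x y → ψ (x +ᵛ y) ≡ ψ x +ᵛ ψ y
    ψ-·         : ∀ a x → ψ (a ·ᵛ x) ≡ a ·ᵛ ψ x
    injective   : ∀ x → ψ x ≡ 0ᵛ → x ≡ 0ᵛ
    sound       : ∀ x → dot u (ψ x) ≡ 0₅
    complete    : ∀ y → dot u y ≡ 0₅ → ∃[ x ] ψ x ≡ y

abstract
  solve-sound : ∀ a b d → b *₅ a ≡ 1₅ → a *₅ (4₅ *₅ (b *₅ d)) +₅ d ≡ 0₅
  solve-sound = from-yes (all? λ a → all? λ b → all? λ d → (b *₅ a ≟ 1₅) →-dec (a *₅ (4₅ *₅ (b *₅ d)) +₅ d ≟ 0₅))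

  solve-complete : ∀ a b d x → b *₅ a ≡ 1₅ → a *₅ x +₅ d ≡ 0₅ → 4₅ *₅ (b *₅ d) ≡ x
  solve-complete = from-yes (all? λ a → all? λ b → all? λ d → all? λ x →
    (b *₅ a ≟ 1₅) →-dec ((a *₅ x +₅ d ≟ 0₅) →-dec (4₅ *₅ (b *₅ d) ≟ x)))

  *₅-comm₃ : ∀ a b c → a *₅ (b *₅ c) ≡ b *₅ (a *₅ c)
  *₅-comm₃ = from-yes (all? λ a → all? λ b → all? λ c → a *₅ (b *₅ c) ≟ b *₅ (a *₅ c))

-- If the first entry of u is nonzero, solve for the first coordinate, where 4 stands for -1;
-- otherwise that coordinate is free and the problem passes to the remaining ones.
parametrise : ∀ (u : Vector (suc r)) → u ≢ 0ᵛ → Parametrisation u r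
parametrise {r} (a ∷ w) u≢0 with a ≟ 0₅
... | no a≢0 = record
  { ψ = λ y → 4₅ *₅ (b *₅ dot w y) ∷ y
  ; ψ-+ = λ x y → cong (_∷ x +ᵛ y) (trans (cong (λ z → 4₅ *₅ (b *₅ z)) (dot-+ᵛʳ w x y))
      (trans (cong (4₅ *₅_) (*₅-distribˡ-+₅ b (dot w x) (dot w y))) (*₅-distribˡ-+₅ 4₅ (b *₅ dot w x) (b *₅ dot w y))))
  ; ψ-· = λ c x → cong (_∷ c ·ᵛ x) (trans (cong (λ z → 4₅ *₅ (b *₅ z)) (dot-·ᵛʳ w c x))
      (trans (cong (4₅ *₅_) (*₅-comm₃ b c (dot w x))) (*₅-comm₃ 4₅ c (b *₅ dot w x))))
  ; injective = λ x eq → proj₂ (∷-injective eq)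
  ; sound = λ x → solve-sound a b (dot w x) b*a≡1
  ; complete = λ { (x ∷ y) eq → y , cong (_∷ y) (solve-complete a b (dot w y) x b*a≡1 eq) } }
  where
  b = proj₁ (inverse₅ a a≢0)
  b*a≡1 = proj₂ (inverse₅ a a≢0)
parametrise {zero} (a ∷ []) u≢0 | yes refl = contradiction refl u≢0
parametrise {suc r} (a ∷ w) u≢0 | yes refl = record
  { ψ = λ { (x ∷ y) → x ∷ ψ y }
  ; ψ-+ = λ { (x ∷ y) (x′ ∷ y′) → cong (x +₅ x′ ∷_) (ψ-+ y y′) }
  ; ψ-· = λ { c (x ∷ y) → cong (c *₅ x ∷_) (ψ-· c y) }
  ; injective = λ { (x ∷ y) eq → cong₂ _∷_ (proj₁ (∷-injective eq)) (injective y (proj₂ (∷-injective eq))) }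
  ; sound = λ { (x ∷ y) → trans (cong (0₅ +₅_) (sound y)) refl }
  ; complete = λ { (x ∷ y) eq → let z , ψz≡y = complete y (trans (sym (+₅-identityˡ _)) eq) in x ∷ z , cong (x ∷_) ψz≡y } }
  where open Parametrisation (parametrise w (u≢0 ∘ cong (0₅ ∷_)))

standardBasis : ∀ k → Vec (Vector k) k
standardBasis zero    = []
standardBasis (suc k) = (1₅ ∷ 0ᵛ) ∷ Vec.map (0₅ ∷_) (standardBasis k)

linearCombination-map : ∀ (ψ : Vector k → Vector r) → (∀ x y → ψ (x +ᵛ y) ≡ ψ x +ᵛ ψ y) → (∀ a x → ψ (a ·ᵛ x) ≡ a ·ᵛ ψ x) →
  ∀ (cs : Vector n) vs → linearCombination cs (Vec.map ψ vs) ≡ ψ (linearCombination cs vs)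
linearCombination-map ψ add hom []       []       = begin
  0ᵛ             ≡⟨ ·ᵛ-zeroˡ (ψ 0ᵛ) ⟨
  0₅ ·ᵛ ψ 0ᵛ     ≡⟨ hom 0₅ 0ᵛ ⟨
  ψ (0₅ ·ᵛ 0ᵛ)   ≡⟨ cong ψ (·ᵛ-zeroʳ 0₅) ⟩
  ψ 0ᵛ           ∎
  where open ≡-Reasoning
linearCombination-map ψ add hom (c ∷ cs) (v ∷ vs) = trans
  (cong₂ _+ᵛ_ (sym (hom c v)) (linearCombination-map ψ add hom cs vs)) (sym (add _ _))

linearCombination-standard : ∀ (cs : Vector k) → linearCombination cs (standardBasis k) ≡ cs
linearCombination-standard []       = refl
linearCombination-standard (c ∷ cs) = trans
  (cong (c ·ᵛ (1₅ ∷ 0ᵛ) +ᵛ_) (trans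
    (linearCombination-map (0₅ ∷_) (λ _ _ → refl) (λ a x → cong (_∷ a ·ᵛ x) (sym (*₅-zeroʳ a))) cs (standardBasis _))
    (cong (0₅ ∷_) (linearCombination-standard cs))))
  (cong₂ _∷_ (trans (+₅-identityʳ _) (trans (*₅-comm c 1₅) (*₅-identityˡ c)))
             (trans (cong (_+ᵛ cs) (·ᵛ-zeroʳ c)) (+ᵛ-identityˡ cs)))

orthogonal-hyperplane : ∀ (u : Vector (suc r)) → u ≢ 0ᵛ → IsHyperplane (orthogonal u)
orthogonal-hyperplane {r} u u≢0 = Vec.map ψ (standardBasis r) , record
  { members = VecAll.map⁺ (VecAll.universal sound (standardBasis r))
  ; independent = λ cs eq → injective cs (trans (sym (image cs)) eq)
  ; spanning = λ {v} v∈ → let x , ψx≡v = complete v v∈ in x , trans (image x) ψx≡v }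
  where
  open Parametrisation (parametrise u u≢0)
  image : ∀ cs → linearCombination cs (Vec.map ψ (standardBasis r)) ≡ ψ cs
  image cs = trans (linearCombination-map ψ ψ-+ ψ-· cs (standardBasis r)) (cong ψ (linearCombination-standard cs))

-- Passing between projective systems and arrangements

abstract
  -- Opaque, so that comparing two counts never unfolds the search through all 5⁵ vectors.
  inside : Subspace r → Vec (Subspace r) n → ℕ
  inside = numberInside

  inside≡numberInside : ∀ (H : Subspace r) (𝒮 : Vec (Subspace r) n) → inside H 𝒮 ≡ numberInside H 𝒮
  inside≡numberInside H 𝒮 = refl

  inside-[] : ∀ (H : Subspace r) → inside H [] ≡ 0
  inside-[] H = refl

  inside-∷-yes : ∀ (H S : Subspace r) (𝒮 : Vec (Subspace r) n) → S ⊆ˢ H → inside H (S ∷ 𝒮) ≡ suc (inside H 𝒮)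
  inside-∷-yes H S 𝒮 S⊆H =
    cong (λ b → (if b then suc else id) (inside H 𝒮)) (dec-true (S ⊆ˢ? H) (λ {x} → S⊆H {x}))

  inside-∷-no : ∀ (H S : Subspace r) (𝒮 : Vec (Subspace r) n) → ¬ (S ⊆ˢ H) → inside H (S ∷ 𝒮) ≡ inside H 𝒮
  inside-∷-no H S 𝒮 S⊈H =
    cong (λ b → (if b then suc else id) (inside H 𝒮)) (dec-false (S ⊆ˢ? H) S⊈H)

  inside-≤-∷ : ∀ (H S : Subspace r) (𝒮 : Vec (Subspace r) n) → inside H 𝒮 ≤ inside H (S ∷ 𝒮)
  inside-≤-∷ H S 𝒮 = by (S ⊆ˢ? H)
    where
    by : Dec (S ⊆ˢ H) → inside H 𝒮 ≤ inside H (S ∷ 𝒮)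
    by (yes S⊆H) = ≤-trans (n≤1+n _) (≤-reflexive (sym (inside-∷-yes H S 𝒮 (λ {x} → S⊆H {x}))))
    by (no S⊈H)  = ≤-reflexive (sym (inside-∷-no H S 𝒮 S⊈H))

  inside-mono : ∀ (H K : Subspace r) → H ⊆ˢ K → (𝒮 : Vec (Subspace r) n) → inside H 𝒮 ≤ inside K 𝒮
  inside-mono H K H⊆K []      = z≤n
  inside-mono H K H⊆K (S ∷ 𝒮) = by (S ⊆ˢ? H)
    where
    rest : inside H 𝒮 ≤ inside K 𝒮
    rest = inside-mono H K (λ {x} → H⊆K {x}) 𝒮
    by : Dec (S ⊆ˢ H) → inside H (S ∷ 𝒮) ≤ inside K (S ∷ 𝒮)
    by (yes S⊆H) = ≤-trans (≤-reflexive (inside-∷-yes H S 𝒮 (λ {x} → S⊆H {x})))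
      (≤-trans (s≤s rest) (≤-reflexive (sym (inside-∷-yes K S 𝒮 (λ {x} x∈ → H⊆K (S⊆H {x} x∈))))))
    by (no S⊈H)  = ≤-trans (≤-reflexive (inside-∷-no H S 𝒮 S⊈H)) (≤-trans rest (inside-≤-∷ K S 𝒮))

spanOf : Generators → Subspace 5
spanOf (v , w) = span (v ∷ w ∷ [])

incidence≡1⇒⊆ : ∀ u L → incidence u L ≡ 1 → spanOf L ⊆ˢ orthogonal u
incidence≡1⇒⊆ u (v , w) eq (cs , refl) with zeros≡1⇒All (v ∷ w ∷ []) {u} eq
... | u⊥v ∷ u⊥w ∷ [] = dot-linearCombination u cs (v ∷ w ∷ []) (u⊥v VecAll.∷ u⊥w VecAll.∷ VecAll.[])

⊆⇒incidence≡1 : ∀ u L → spanOf L ⊆ˢ orthogonal u → incidence u L ≡ 1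
⊆⇒incidence≡1 u (v , w) ⊆ with span-members (v ∷ w ∷ [])
... | v∈ VecAll.∷ w∈ VecAll.∷ VecAll.[] = cong₂ (λ x y → [ x ≡0] * ([ y ≡0] * 1)) (⊆ v∈) (⊆ w∈)

system : (ls : List Generators) → Vec (Subspace 5) (length ls)
system []       = []
system (L ∷ ls) = spanOf L ∷ system ls

inside-system : ∀ ls u → inside (orthogonal u) (system ls) ≡ count⊥ ls u
inside-system []       u = inside-[] (orthogonal u)
inside-system (L ∷ ls) u = by (zeros≤1 (list L) u) refl
  where
  by : ∀ {z} → z ≤ 1 → incidence u L ≡ z → inside (orthogonal u) (system (L ∷ ls)) ≡ incidence u L + count⊥ ls u
  by {1} _ eq = trans
    (inside-∷-yes (orthogonal u) (spanOf L) (system ls) (λ {x} → incidence≡1⇒⊆ u L eq {x}))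
    (cong₂ _+_ (sym eq) (inside-system ls u))
  by {0} _ eq = trans
    (inside-∷-no (orthogonal u) (spanOf L) (system ls)
      λ ⊆ → contradiction (trans (sym eq) (⊆⇒incidence≡1 u L (λ {x} → ⊆ {x}))) λ ())
    (cong₂ _+_ (sym eq) (inside-system ls u))
  by {suc (suc _)} (s≤s ()) _

-- The four basis vectors of H impose four conditions in dimension 5. Inclusion bounds the counts,
-- since these are monotone in the hyperplane.
hyperplane⊆orthogonal : ∀ (H : Subspace 5) → IsHyperplane H → ∃[ u ] (u ≢ 0ᵛ × H ⊆ˢ orthogonal u)
hyperplane⊆orthogonal H (vs , basis) =
  let u , u≢0 , u⊥ = orthogonal-vector (toList vs) (s≤s (≤-reflexive (length-toList vs)))
  in u , u≢0 , λ x∈ → let cs , eq = spanning basis x∈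
                      in subst (λ z → dot u z ≡ 0₅) eq (dot-linearCombination u cs vs (fromToList vs u⊥))
  where
  fromToList : ∀ {k} {P : Vector 5 → Set} (vs : Vec (Vector 5) k) → All P (toList vs) → VecAll.All P vs
  fromToList []       []       = VecAll.[]
  fromToList (v ∷ vs) (p ∷ ps) = p VecAll.∷ fromToList vs ps

system-bounded : ∀ ls → Bounded s ls → ∀ H → IsHyperplane H → inside H (system ls) ≤ s
system-bounded ls bounded H hyp =
  let u , u≢0 , H⊆ = hyperplane⊆orthogonal H hyp
  in ≤-trans (inside-mono H (orthogonal u) (λ {x} → H⊆ {x}) (system ls))
       (≤-trans (≤-reflexive (inside-system ls u)) (bounded u u≢0))

system-dimension : ∀ ls → VecAll.All (λ S → ∃[ d ] (d ≤ 2 × HasDimension S d)) (system ls)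
system-dimension []             = VecAll.[]
system-dimension ((v , w) ∷ ls) = span-dimension (v ∷ w ∷ []) VecAll.∷ system-dimension ls

-- A basis is padded with zero vectors to a pair. The implication makes the counts of the
-- arrangement at most those of the system.
generators : ∀ (S : Subspace 5) → ∃[ d ] (d ≤ 2 × HasDimension S d) →
  ∃[ L ] (∀ u → incidence u L ≡ 1 → S ⊆ˢ orthogonal u)
generators S (0 , _ , [] , basis) = (0ᵛ , 0ᵛ) , λ u eq x∈ → let cs , lc≡ = spanning basis x∈
  in subst (λ z → dot u z ≡ 0₅) lc≡ (dot-linearCombination u cs [] VecAll.[])
generators S (1 , _ , v ∷ [] , basis) = (v , 0ᵛ) , λ u eq x∈ → let cs , lc≡ = spanning basis x∈
  in subst (λ z → dot u z ≡ 0₅) lc≡ (dot-linearCombination u cs (v ∷ []) (first u eq VecAll.∷ VecAll.[]))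
  where
  first : ∀ u → incidence u (v , 0ᵛ) ≡ 1 → dot u v ≡ 0₅
  first u eq with zeros≡1⇒All (v ∷ 0ᵛ ∷ []) {u} eq
  ... | u⊥v ∷ _ = u⊥v
generators S (2 , _ , v ∷ w ∷ [] , basis) = (v , w) , λ u eq x∈ → let cs , lc≡ = spanning basis x∈
  in incidence≡1⇒⊆ u (v , w) eq (cs , lc≡)
generators S (suc (suc (suc _)) , s≤s (s≤s ()) , _)

toArrangement : ∀ (𝒮 : Vec (Subspace 5) n) → VecAll.All (λ S → ∃[ d ] (d ≤ 2 × HasDimension S d)) 𝒮 →
  ∃[ ls ] (length ls ≡ n × ∀ u → count⊥ ls u ≤ inside (orthogonal u) 𝒮)
toArrangement []      VecAll.[]           = [] , refl , λ u → z≤n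
toArrangement (S ∷ 𝒮) (dim VecAll.∷ dims) = L ∷ ls , cong suc (proj₁ (proj₂ rest)) , count-∷
  where
  rest = toArrangement 𝒮 dims
  L = proj₁ (generators S dim)
  annihilated = proj₂ (generators S dim)
  ls = proj₁ rest
  le = proj₂ (proj₂ rest)
  count-∷ : ∀ u → count⊥ (L ∷ ls) u ≤ inside (orthogonal u) (S ∷ 𝒮)
  count-∷ u = by (zeros≤1 (list L) u) refl
    where
    by : ∀ {z} → z ≤ 1 → incidence u L ≡ z → incidence u L + count⊥ ls u ≤ inside (orthogonal u) (S ∷ 𝒮)
    by {1} _ eq = ≤-trans (+-mono-≤ (≤-reflexive eq) (le u))
      (≤-reflexive (sym (inside-∷-yes (orthogonal u) S 𝒮 (λ {x} → annihilated u eq {x}))))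
    by {0} _ eq = ≤-trans (+-mono-≤ (≤-reflexive eq) (le u)) (inside-≤-∷ (orthogonal u) S 𝒮)
    by {suc (suc _)} (s≤s ()) _

systemExists⇒arrangement : SystemExists 5 2 s n → Arrangement s n
systemExists⇒arrangement (𝒮 , isSystem) =
  let ls , len , le = toArrangement 𝒮 (IsProjectiveSystem.dimension≤h isSystem)
  in ls , len , λ u u≢0 →
    ≤-trans (≤-trans (le u) (≤-reflexive (inside≡numberInside (orthogonal u) 𝒮))) (IsProjectiveSystem.inside≤s isSystem (orthogonal u) (orthogonal-hyperplane u u≢0))

-- Existence of the maximum

count⊥-take : ∀ k ls u → count⊥ (take k ls) u ≤ count⊥ ls u
count⊥-take zero    ls       u = z≤n
count⊥-take (suc k) []       u = z≤n
count⊥-take (suc k) (L ∷ ls) u = +-monoʳ-≤ (incidence u L) (count⊥-take k ls u)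

arrangement-≤ : m ≤ n → Arrangement s n → Arrangement s m
arrangement-≤ {m} m≤n (ls , refl , bounded) =
  take m ls , trans (length-take m ls) (m≤n⇒m⊓n≡m m≤n) , λ u u≢0 → ≤-trans (count⊥-take m ls u) (bounded u u≢0)

-- The zero subspace lies in every hyperplane, so adding it raises each count by exactly one.
arrangement-suc : Arrangement s n → Arrangement (suc s) (suc n)
arrangement-suc (ls , len , bounded) = (0ᵛ , 0ᵛ) ∷ ls , cong suc len , λ u u≢0 →
  +-mono-≤ (zeros≤1 (list (0ᵛ , 0ᵛ)) u) (bounded u u≢0)

abstract
  bounded? : ∀ s ls → Dec (Bounded s ls)
  bounded? s ls = allVectors? λ u → ¬? (u ≟ᵛ 0ᵛ) →-dec (count⊥ ls u ≤? s)

  -- An exhaustive search over lists of n pairs, far too long to run; it makes the maximum exist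
  -- constructively.
  arrangement? : ∀ s n → Dec (Arrangement s n)
  arrangement? s n = map′
    (λ { (ls , bounded) → toList ls , length-toList ls , bounded })
    (λ { (ls , refl , bounded) → fromList ls , subst (Bounded s) (sym (toList∘fromList ls)) bounded })
    (vec-searchable (pair-searchable vector-searchable vector-searchable) λ ls → bounded? s (toList ls))

maximumSize : Arrangement (suc s) n → ¬ Arrangement (suc s) (suc n) → n⟨ suc s ⟩≡ n
maximumSize {s} {n} arr@(ls , refl , bounded) none = record
  { exists  = system ls , record
      { dimension≤h = system-dimension ls
      ; inside≤s = λ H hyp → ≤-trans (≤-reflexive (sym (inside≡numberInside H (system ls)))) (system-bounded ls bounded H hyp)
      ; attained = attained (vector-searchable λ u → ¬? (u ≟ᵛ 0ᵛ) ×-dec (count⊥ ls u ≟ℕ suc s)) }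
  ; maximal = λ m sys → ≮⇒≥ λ n<m → none (arrangement-≤ n<m (systemExists⇒arrangement sys)) }
  where
  attained : Dec (∃[ u ] (u ≢ 0ᵛ × count⊥ ls u ≡ suc s)) → ∃[ H ] (IsHyperplane H × numberInside H (system ls) ≡ suc s)
  attained (yes (u , u≢0 , eq)) = orthogonal u , orthogonal-hyperplane u u≢0 , trans (sym (inside≡numberInside (orthogonal u) (system ls))) (trans (inside-system ls u) eq)
  attained (no ¬attained) = contradiction
    (arrangement-suc (ls , refl , λ u u≢0 → ≤-pred (≤∧≢⇒< (bounded u u≢0) λ eq → ¬attained (u , u≢0 , eq)))) none

-- Starting from `lo`, increase the size as long as a larger arrangement exists; `none` bounds the
-- climb.
maximum-between : Arrangement (suc s) lo → ¬ Arrangement (suc s) (suc hi) → lo ≤n⟨ suc s ⟩≤ hi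
maximum-between {s} {lo} {hi} arr none = climb (suc hi ∸ lo) lo ≤-refl (m≤n+m∸n (suc hi) lo) arr
  where
  climb : ∀ fuel k → lo ≤ k → suc hi ≤ k + fuel → Arrangement (suc s) k → lo ≤n⟨ suc s ⟩≤ hi
  climb zero k _ hi<k arr = contradiction (arrangement-≤ (≤-trans hi<k (≤-reflexive (+-identityʳ k))) arr) none
  climb (suc fuel) k lo≤k hi<k+fuel arr with arrangement? (suc s) (suc k)
  ... | yes arr′ = climb fuel (suc k) (m≤n⇒m≤1+n lo≤k) (≤-trans hi<k+fuel (≤-reflexive (+-suc k fuel))) arr′
  ... | no none′ = k , maximumSize arr none′ , lo≤k , ≮⇒≥ λ hi<k → none (arrangement-≤ hi<k arr)

-- Verification by computation with natural numbers

-- Natural numbers are evaluated by built-in arithmetic; checks are run on them and transferred to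
-- 𝔽₅ by `reduce`.
RawVector : ℕ → Set
RawVector = Vec ℕ

RawGenerators : Set
RawGenerators = RawVector 5 × RawVector 5

reduce : RawVector r → Vector r
reduce = Vec.map (_mod 5)

reduceGenerators : RawGenerators → Generators
reduceGenerators (v , w) = reduce v , reduce w

rawDot : RawVector r → RawVector r → ℕ
rawDot []      []      = 0
rawDot (a ∷ u) (b ∷ v) = a * b + rawDot u v

toℕ-mod : ∀ x → toℕ (x mod 5) ≡ x % 5
toℕ-mod x = toℕ-fromℕ< (m%n<n x 5)

%5-+ : ∀ x y → (x % 5 + y % 5) % 5 ≡ (x + y) % 5
%5-+ x y = sym (%-distribˡ-+ x y 5)

dot-reduce : ∀ (u v : RawVector r) → toℕ (dot (reduce u) (reduce v)) ≡ rawDot u v % 5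
dot-reduce []      []      = refl
dot-reduce (a ∷ u) (b ∷ v) = begin
  toℕ ((a mod 5) *₅ (b mod 5) +₅ dot (reduce u) (reduce v))
    ≡⟨ toℕ-mod (toℕ ((a mod 5) *₅ (b mod 5)) + toℕ (dot (reduce u) (reduce v))) ⟩
  (toℕ ((a mod 5) *₅ (b mod 5)) + toℕ (dot (reduce u) (reduce v))) % 5
    ≡⟨ cong₂ (λ x y → (x + y) % 5) product (dot-reduce u v) ⟩
  (a * b % 5 + rawDot u v % 5) % 5
    ≡⟨ %5-+ (a * b) (rawDot u v) ⟩
  (a * b + rawDot u v) % 5 ∎
  where
  open ≡-Reasoning
  product : toℕ ((a mod 5) *₅ (b mod 5)) ≡ a * b % 5
  product = trans (toℕ-mod (toℕ (a mod 5) * toℕ (b mod 5))) (trans (cong₂ (λ x y → x * y % 5) (toℕ-mod a) (toℕ-mod b)) (sym (%-distribˡ-* a b 5)))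

isZero : ℕ → ℕ
isZero zero    = 1
isZero (suc _) = 0

[≡0]-isZero : ∀ a → [ a ≡0] ≡ isZero (toℕ a)
[≡0]-isZero zero    = refl
[≡0]-isZero (suc _) = refl

-- The product of two zero indicators, arranged so that the second argument is ignored when the
-- first is nonzero.
andThen : ℕ → ℕ → ℕ
andThen zero    y = isZero y
andThen (suc _) y = 0

andThen-* : ∀ x y → isZero x * (isZero y * 1) ≡ andThen x y
andThen-* zero    y = trans (+-identityʳ _) (*-identityʳ _)
andThen-* (suc _) y = refl

rawIncidence : RawVector 5 → RawGenerators → ℕ
rawIncidence u (v , w) = andThen (rawDot u v % 5) (rawDot u w % 5)

incidence-reduce : ∀ u L → incidence (reduce u) (reduceGenerators L) ≡ rawIncidence u L
incidence-reduce u (v , w) = trans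
  (cong₂ (λ x y → x * (y * 1)) (indicator v) (indicator w))
  (andThen-* (rawDot u v % 5) (rawDot u w % 5))
  where
  indicator : ∀ v → [ dot (reduce u) (reduce v) ≡0] ≡ isZero (rawDot u v % 5)
  indicator v = trans ([≡0]-isZero (dot (reduce u) (reduce v))) (cong isZero (dot-reduce u v))

rawCount : List RawGenerators → RawVector 5 → ℕ
rawCount []       u = 0
rawCount (L ∷ ls) u = rawIncidence u L + rawCount ls u

count⊥-reduce : ∀ ls u → count⊥ (map reduceGenerators ls) (reduce u) ≡ rawCount ls u
count⊥-reduce []       u = refl
count⊥-reduce (L ∷ ls) u = cong₂ _+_ (incidence-reduce u L) (count⊥-reduce ls u)

[≡0]-* : ∀ a x → a ≢ 0₅ → [ a *₅ x ≡0] ≡ [ x ≡0]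
[≡0]-* a zero    a≢0 = cong [_≡0] (*₅-zeroʳ a)
[≡0]-* a (suc i) a≢0 = nonzero (λ ax≡0 → contradiction (*₅-nonzero a (suc i) a≢0 ax≡0) λ ())
  where
  nonzero : ∀ {y} → y ≢ 0₅ → [ y ≡0] ≡ 0
  nonzero {zero}  y≢0 = contradiction refl y≢0
  nonzero {suc _} y≢0 = refl

-- Proportional vectors define the same hyperplane, so one representative of each projective point
-- is checked.
count⊥-· : ∀ ls a u → a ≢ 0₅ → count⊥ ls (a ·ᵛ u) ≡ count⊥ ls u
count⊥-· ls a u a≢0 = Σ-cong ls λ (v , w) →
  cong₂ (λ x y → x * (y * 1)) (scale v) (scale w)
  where
  scale : ∀ v → [ dot (a ·ᵛ u) v ≡0] ≡ [ dot u v ≡0]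
  scale v = trans (cong [_≡0] (dot-·ᵛˡ a u v)) ([≡0]-* a (dot u v) a≢0)

allVectors : ∀ r → (RawVector r → Bool) → Bool
allVectors zero    p = p []
allVectors (suc r) p =
  allVectors r (p ∘ (0 ∷_)) ∧ (allVectors r (p ∘ (1 ∷_)) ∧ (allVectors r (p ∘ (2 ∷_)) ∧
  (allVectors r (p ∘ (3 ∷_)) ∧ allVectors r (p ∘ (4 ∷_)))))

-- One vector for each point of projective space: the first nonzero entry is 1.
allPoints : ∀ r → (RawVector r → Bool) → Bool
allPoints zero    p = true
allPoints (suc r) p = allPoints r (p ∘ (0 ∷_)) ∧ allVectors r (p ∘ (1 ∷_))

∧-true : ∀ {a b} → a ∧ b ≡ true → a ≡ true × b ≡ true
∧-true {true} eq = refl , eq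

allVectors-sound : ∀ (p : RawVector r → Bool) → allVectors r p ≡ true → ∀ (v : Vector r) → p (Vec.map toℕ v) ≡ true
allVectors-sound p ok []      = ok
allVectors-sound p ok (a ∷ v) = let
    ok₀ , rest₀ = ∧-true ok
    ok₁ , rest₁ = ∧-true rest₀
    ok₂ , rest₂ = ∧-true rest₁
    ok₃ , ok₄   = ∧-true rest₂
    choose : ∀ a → allVectors _ (p ∘ (toℕ a ∷_)) ≡ true
    choose = λ { 0₅ → ok₀ ; 1₅ → ok₁ ; 2₅ → ok₂ ; 3₅ → ok₃ ; 4₅ → ok₄ }
  in allVectors-sound (p ∘ (toℕ a ∷_)) (choose a) v

reduce-toℕ : (v : Vector r) → reduce (Vec.map toℕ v) ≡ v
reduce-toℕ []      = refl
reduce-toℕ (a ∷ v) = cong₂ _∷_ (lemma a) (reduce-toℕ v)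
  where
  lemma : ∀ a → toℕ a mod 5 ≡ a
  lemma = from-yes (all? λ a → toℕ a mod 5 ≟ a)

allPoints-sound : ∀ (p : RawVector r → Bool) → allPoints r p ≡ true → ∀ u → u ≢ 0ᵛ →
  ∃[ a ] ∃[ v ] (a ≢ 0₅ × u ≡ a ·ᵛ reduce v × p v ≡ true)
allPoints-sound p ok []          u≢0 = contradiction refl u≢0
allPoints-sound p ok (zero  ∷ u) u≢0 with allPoints-sound (p ∘ (0 ∷_)) (proj₁ (∧-true ok)) u (u≢0 ∘ cong (0₅ ∷_))
... | a , v , a≢0 , eq , pv = a , 0 ∷ v , a≢0 , cong₂ _∷_ (sym (*₅-zeroʳ a)) eq , pv
-- Dividing by the leading entry gives the representative that was checked.
allPoints-sound p ok (a@(suc i) ∷ u) u≢0 = a , 1 ∷ Vec.map toℕ (b ·ᵛ u) , (λ ()) ,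
  cong₂ _∷_ (trans (sym (*₅-identityˡ a)) (*₅-comm 1₅ a)) (begin
    u                                        ≡⟨ ·ᵛ-identity u ⟨
    1₅ ·ᵛ u                                  ≡⟨ cong (_·ᵛ u) (trans (sym (proj₂ inv)) (*₅-comm b a)) ⟩
    (a *₅ b) ·ᵛ u                            ≡⟨ ·ᵛ-assoc a b u ⟩
    a ·ᵛ (b ·ᵛ u)                            ≡⟨ cong (a ·ᵛ_) (reduce-toℕ (b ·ᵛ u)) ⟨
    a ·ᵛ reduce (Vec.map toℕ (b ·ᵛ u))       ∎) ,
  allVectors-sound (p ∘ (1 ∷_)) (proj₂ (∧-true ok)) (b ·ᵛ u)
  where
  open ≡-Reasoning
  inv = inverse₅ a λ ()
  b = proj₁ inv

≤ᵇ-sound : ∀ {m n} → (m ≤ᵇ n) ≡ true → m ≤ n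
≤ᵇ-sound {m} {n} eq = ≤ᵇ⇒≤ m n (subst Data.Bool.T (sym eq) _)

everyHyperplane : (List RawGenerators → RawVector 5 → Bool) → List RawGenerators → Bool
everyHyperplane p ls = allPoints 5 (p ls)

checkBounded : ℕ → List RawGenerators → Bool
checkBounded s ls = everyHyperplane (λ ls u → rawCount ls u ≤ᵇ s) ls

checked : ∀ s ls → checkBounded s ls ≡ true → Bounded s (map reduceGenerators ls)
checked s ls ok u u≢0 with allPoints-sound (λ u → rawCount ls u ≤ᵇ s) ok u u≢0
... | a , v , a≢0 , refl , le = ≤-trans
  (≤-reflexive (trans (count⊥-· (map reduceGenerators ls) a (reduce v) a≢0) (count⊥-reduce ls v)))
  (≤ᵇ-sound le)

Matrix : Set
Matrix = Vec (RawVector 5) 5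

infixr 8 _⊙_

_⊙_ : Matrix → RawGenerators → RawGenerators
A ⊙ (v , w) = image v , image w
  where
  image : RawVector 5 → RawVector 5
  image v = Vec.map (λ row → rawDot row v % 5) A

-- A compact notation for `k` successive images of one line; the bounds of a list built from it are
-- verified by evaluation.
orbit : ℕ → Matrix → RawGenerators → List RawGenerators
orbit k A L = iterate (A ⊙_) L k

-- Arrangements from lifted lines and line spreads

arrangement-+ : Arrangement s n → Arrangement s′ n′ → Arrangement (s + s′) (n + n′)
arrangement-+ (ls , refl , bounded) (ls′ , refl , bounded′) = ls ++ ls′ , length-++ ls , λ u u≢0 →
  ≤-trans (≤-reflexive (Σ-++ ls ls′ (incidence u))) (+-mono-≤ (bounded u u≢0) (bounded′ u u≢0))

arrangement-raw : ∀ ls → (length ls ≡ᵇ n) ∧ checkBounded s ls ≡ true → Arrangement s n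
arrangement-raw {n} {s} ls ok =
  let len , bounded = ∧-true {length ls ≡ᵇ n} ok
  in map reduceGenerators ls ,
     trans (length-map reduceGenerators ls) (≡ᵇ⇒≡ (length ls) n (subst T (sym len) _)) ,
     checked s ls bounded

copies : ℕ → List RawGenerators → List RawGenerators
copies zero    ls = []
copies (suc k) ls = ls ++ copies k ls

rawCount-++ : ∀ ls ls′ u → rawCount (ls ++ ls′) u ≡ rawCount ls u + rawCount ls′ u
rawCount-++ []       ls′ u = refl
rawCount-++ (L ∷ ls) ls′ u = trans (cong (rawIncidence u L +_) (rawCount-++ ls ls′ u)) (sym (+-assoc (rawIncidence u L) _ _))

rawCount-copies : ∀ k ls u → rawCount (copies k ls) u ≡ k * rawCount ls u
rawCount-copies zero    ls u = refl
rawCount-copies (suc k) ls u = trans (rawCount-++ ls (copies k ls) u) (cong (rawCount ls u +_) (rawCount-copies k ls u))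

length-copies : ∀ k (ls : List RawGenerators) → length (copies k ls) ≡ k * length ls
length-copies zero    ls = refl
length-copies (suc k) ls = trans (length-++ ls) (cong (length ls +_) (length-copies k ls))

rawIncidence≤1 : ∀ u L → rawIncidence u L ≤ 1
rawIncidence≤1 u (v , w) = bound (rawDot u v % 5) (rawDot u w % 5)
  where
  bound : ∀ x y → andThen x y ≤ 1
  bound zero    zero    = ≤-refl
  bound zero    (suc _) = z≤n
  bound (suc _) _       = z≤n

rawCount-take : ∀ a ls u → rawCount (take a ls) u ≤ a
rawCount-take zero    ls       u = z≤n
rawCount-take (suc a) []       u = z≤n
rawCount-take (suc a) (L ∷ ls) u = +-mono-≤ (rawIncidence≤1 u L) (rawCount-take a ls u)

rawCount-take≤ : ∀ a ls u → rawCount (take a ls) u ≤ rawCount ls u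
rawCount-take≤ zero    ls       u = z≤n
rawCount-take≤ (suc a) []       u = z≤n
rawCount-take≤ (suc a) (L ∷ ls) u = +-monoʳ-≤ (rawIncidence u L) (rawCount-take≤ a ls u)

-- A line of π that belongs to the chosen spreads of all six solids. Each spread is split into this
-- line and 25 affine ones.
lineAtInfinity : RawGenerators
lineAtInfinity = (0 ∷ 0 ∷ 0 ∷ 1 ∷ 0 ∷ []) , (0 ∷ 0 ∷ 0 ∷ 0 ∷ 1 ∷ [])

allAtMost : ℕ → List ℕ → Bool
allAtMost m []       = true
allAtMost m (x ∷ xs) = (x ≤ᵇ m) ∧ allAtMost m xs

atMostOneNonzero : List ℕ → Bool
atMostOneNonzero []           = true
atMostOneNonzero (zero  ∷ xs) = atMostOneNonzero xs
atMostOneNonzero (suc _ ∷ xs) = allAtMost 0 xs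

counts : List (List RawGenerators) → RawVector 5 → List ℕ
counts Ss u = map (λ S → rawCount S u) Ss

-- Meant for the hyperplanes not containing π: the allowance `1 ∸ rawIncidence u lineAtInfinity`
-- says that each spread, completed by `lineAtInfinity`, has at most one line in the hyperplane.
transverse : List RawGenerators → List (List RawGenerators) → RawVector 5 → Bool
transverse M Ss u = (rawCount M u ≤ᵇ 5) ∧ allAtMost (1 ∸ rawIncidence u lineAtInfinity) (counts Ss u)

-- Meant for the six solids through π: such a solid contains no lifted line, and affine lines of one
-- spread only.
containing : List RawGenerators → List (List RawGenerators) → RawVector 5 → Bool
containing M Ss u = (rawCount M u ≤ᵇ 0) ∧ atMostOneNonzero (counts Ss u)

classify : List RawGenerators → List (List RawGenerators) → RawVector 5 → Bool
classify M Ss u = transverse M Ss u ∨ containing M Ss u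

abstract
  -- The lines {(x , α x)}, for x in the plane ⟨1 , ω⟩ of 𝔽₁₂₅ and α in 𝔽₁₂₅ with
  -- ω³ = 4 ω + 4: they are disjoint from the plane π = {x₁ = x₂ = 0}.
  liftedLines : List RawGenerators
  liftedLines = concatMap (λ a → concatMap (λ b → map (λ c →
      (1 ∷ 0 ∷ a ∷ b ∷ c ∷ []) , (0 ∷ 1 ∷ 4 * c ∷ a + 4 * c ∷ b ∷ []))
    (upTo 5)) (upTo 5)) (upTo 5)

  -- The lines {(x , β x)}, β ∈ 𝔽₂₅, of the regular spread of the solid spanned by
  -- (x₁ , x₂ , 0 , 0 , 0) and π; the missing line of the spread is lineAtInfinity, contained in π.
  affineSpread : ℕ × ℕ → List RawGenerators
  affineSpread (x₁ , x₂) = concatMap (λ e → map (λ f →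
      (x₁ ∷ x₂ ∷ 0 ∷ e ∷ f ∷ []) , (0 ∷ 0 ∷ 1 ∷ 2 * f ∷ e ∷ []))
    (upTo 5)) (upTo 5)

  affineSpreads : List (List RawGenerators)
  affineSpreads = map affineSpread ((0 , 1) ∷ map (1 ,_) (upTo 5))

  length-liftedLines : length liftedLines ≡ 125
  length-liftedLines = refl

  length-affineSpreads : length affineSpreads ≡ 6
  length-affineSpreads = refl

  length-affineSpread : All (λ S → length S ≡ 25) affineSpreads
  length-affineSpread = refl ∷ refl ∷ refl ∷ refl ∷ refl ∷ refl ∷ []

  -- The one evaluation over all hyperplanes behind the constructions from lifted lines and spreads;
  -- larger lists are treated through `Meets`.
  classified : allPoints 5 (classify liftedLines affineSpreads) ≡ true
  classified = refl

∨-true : ∀ {a b} → a ∨ b ≡ true → a ≡ true ⊎ b ≡ true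
∨-true {true}  eq = inj₁ refl
∨-true {false} eq = inj₂ eq

partial : ℕ → ℕ → List (List RawGenerators) → List RawGenerators
partial zero    a Ss       = []
partial (suc m) a []       = []
partial (suc m) a (S ∷ Ss) = take a S ++ partial m a Ss

-- Here `i` is the incidence of `lineAtInfinity`. The summand `m * i` leaves room for m copies of
-- that line, as complete spreads require.
partial-transverse : ∀ m a Ss u {i} → i ≤ 1 → allAtMost (1 ∸ i) (counts Ss u) ≡ true → rawCount (partial m a Ss) u + m * i ≤ m
partial-transverse zero    a Ss       u i≤1 ok = ≤-refl
partial-transverse (suc m) a []       u {i} i≤1 ok = ≤-trans (*-monoʳ-≤ (suc m) i≤1) (≤-reflexive (*-identityʳ (suc m)))
partial-transverse (suc m) a (S ∷ Ss) u {i} i≤1 ok = begin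
  rawCount (take a S ++ partial m a Ss) u + (i + m * i)
    ≡⟨ cong (_+ (i + m * i)) (rawCount-++ (take a S) (partial m a Ss) u) ⟩
  rawCount (take a S) u + rawCount (partial m a Ss) u + (i + m * i)
    ≡⟨ regroup (rawCount (take a S) u) (rawCount (partial m a Ss) u) i (m * i) ⟩
  rawCount (take a S) u + i + (rawCount (partial m a Ss) u + m * i)
    ≤⟨ +-mono-≤ (+-monoˡ-≤ i (≤-trans (rawCount-take≤ a S u) (≤ᵇ-sound (proj₁ (∧-true ok)))))
                (partial-transverse m a Ss u i≤1 (proj₂ (∧-true ok))) ⟩
  (1 ∸ i) + i + m
    ≡⟨ cong (_+ m) (m∸n+n≡m i≤1) ⟩
  suc m ∎
  where
  open ≤-Reasoning
  regroup : ∀ a b c d → a + b + (c + d) ≡ a + c + (b + d)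
  regroup = solve-∀

partial-zero : ∀ m a Ss u → allAtMost 0 (counts Ss u) ≡ true → rawCount (partial m a Ss) u ≡ 0
partial-zero zero    a Ss       u ok = refl
partial-zero (suc m) a []       u ok = refl
partial-zero (suc m) a (S ∷ Ss) u ok = trans (rawCount-++ (take a S) (partial m a Ss) u)
  (cong₂ _+_ (n≤0⇒n≡0 (≤-trans (rawCount-take≤ a S u) (≤ᵇ-sound (proj₁ (∧-true ok)))))
             (partial-zero m a Ss u (proj₂ (∧-true ok))))

-- Only one of the truncated spreads can have lines in such a hyperplane, and it consists of at most
-- `a` lines.
partial-containing : ∀ m a Ss u → atMostOneNonzero (counts Ss u) ≡ true → rawCount (partial m a Ss) u ≤ a
partial-containing zero    a Ss       u ok = z≤n
partial-containing (suc m) a []       u ok = z≤n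
partial-containing (suc m) a (S ∷ Ss) u ok = ≤-trans
  (≤-reflexive (rawCount-++ (take a S) (partial m a Ss) u)) (by (rawCount S u) refl)
  where
  by : ∀ c → rawCount S u ≡ c → rawCount (take a S) u + rawCount (partial m a Ss) u ≤ a
  by zero    eq = +-mono-≤ {_} {0} (≤-trans (rawCount-take≤ a S u) (≤-reflexive eq))
    (partial-containing m a Ss u (subst (λ c → atMostOneNonzero (c ∷ counts Ss u) ≡ true) eq ok))
  by (suc c) eq = ≤-trans (+-mono-≤ (rawCount-take a S u) (≤-reflexive (partial-zero m a Ss u
    (subst (λ c → atMostOneNonzero (c ∷ counts Ss u) ≡ true) eq ok)))) (≤-reflexive (+-identityʳ a))

-- For a = 25 and m ≤ 6 these are complete spreads of m of the solids.
bundle : ℕ → ℕ → List RawGenerators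
bundle m a = copies m (lineAtInfinity ∷ []) ++ partial m a affineSpreads

-- Separate bounds for the two kinds of hyperplanes; both add up under union, so a construction
-- reduces to two totals.
record Meets (ls : List RawGenerators) (t c : ℕ) : Set where
  field
    ifTransverse : ∀ u → transverse liftedLines affineSpreads u ≡ true → rawCount ls u ≤ t
    ifContaining : ∀ u → containing liftedLines affineSpreads u ≡ true → rawCount ls u ≤ c

open Meets

private
  variable
    ls ls′ : List RawGenerators

meets-++ : Meets ls t c → Meets ls′ t′ c′ → Meets (ls ++ ls′) (t + t′) (c + c′)
meets-++ {ls} {ls′ = ls′} M M′ .ifTransverse u ok =
  ≤-trans (≤-reflexive (rawCount-++ ls ls′ u)) (+-mono-≤ (ifTransverse M u ok) (ifTransverse M′ u ok))
meets-++ {ls} {ls′ = ls′} M M′ .ifContaining u ok =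
  ≤-trans (≤-reflexive (rawCount-++ ls ls′ u)) (+-mono-≤ (ifContaining M u ok) (ifContaining M′ u ok))

meets-copies : ∀ k → Meets ls t c → Meets (copies k ls) (k * t) (k * c)
meets-copies {ls} k M .ifTransverse u ok = ≤-trans (≤-reflexive (rawCount-copies k ls u)) (*-monoʳ-≤ k (ifTransverse M u ok))
meets-copies {ls} k M .ifContaining u ok = ≤-trans (≤-reflexive (rawCount-copies k ls u)) (*-monoʳ-≤ k (ifContaining M u ok))

meets-lifted : Meets liftedLines 5 0
meets-lifted .ifTransverse u ok = ≤ᵇ-sound (proj₁ (∧-true {rawCount liftedLines u ≤ᵇ 5} ok))
meets-lifted .ifContaining u ok = ≤ᵇ-sound (proj₁ (∧-true {rawCount liftedLines u ≤ᵇ 0} ok))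

meets-partial : ∀ m a → Meets (partial m a affineSpreads) m a
meets-partial m a .ifTransverse u ok = ≤-trans (m≤m+n _ _)
  (partial-transverse m a affineSpreads u (rawIncidence≤1 u lineAtInfinity) (proj₂ (∧-true {rawCount liftedLines u ≤ᵇ 5} ok)))
meets-partial m a .ifContaining u ok = partial-containing m a affineSpreads u (proj₂ (∧-true {rawCount liftedLines u ≤ᵇ 0} ok))

meets-bundle : ∀ m a → Meets (bundle m a) m (m + a)
meets-bundle m a .ifTransverse u ok = ≤-trans
  (≤-reflexive (trans (rawCount-++ (copies m (lineAtInfinity ∷ [])) (partial m a affineSpreads) u)
    (trans (+-comm (rawCount (copies m (lineAtInfinity ∷ [])) u) _)
      (cong (rawCount (partial m a affineSpreads) u +_)
        (trans (rawCount-copies m (lineAtInfinity ∷ []) u) (cong (m *_) (+-identityʳ _)))))))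
  (partial-transverse m a affineSpreads u (rawIncidence≤1 u lineAtInfinity) (proj₂ (∧-true {rawCount liftedLines u ≤ᵇ 5} ok)))
meets-bundle m a .ifContaining u ok = ≤-trans
  (≤-reflexive (rawCount-++ (copies m (lineAtInfinity ∷ [])) (partial m a affineSpreads) u))
  (+-mono-≤ (≤-trans (≤-reflexive (rawCount-copies m (lineAtInfinity ∷ []) u))
              (≤-trans (*-monoʳ-≤ m (≤-trans (≤-reflexive (+-identityʳ _)) (rawIncidence≤1 u lineAtInfinity))) (≤-reflexive (*-identityʳ m))))
            (partial-containing m a affineSpreads u (proj₂ (∧-true {rawCount liftedLines u ≤ᵇ 0} ok))))

meets-bounded : t ≤ s → c ≤ s → Meets ls t c → Bounded s (map reduceGenerators ls)
meets-bounded {s = s} {ls = ls} t≤s c≤s M u u≢0 =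
  let a , v , a≢0 , u≡av , ok = allPoints-sound (classify liftedLines affineSpreads) classified u u≢0
  in subst (λ u → count⊥ (map reduceGenerators ls) u ≤ s) (sym u≡av) (≤-trans
    (≤-reflexive (trans (count⊥-· (map reduceGenerators ls) a (reduce v) a≢0) (count⊥-reduce ls v)))
    (by v (∨-true {transverse liftedLines affineSpreads v} ok)))
  where
  by : ∀ v → transverse liftedLines affineSpreads v ≡ true ⊎ containing liftedLines affineSpreads v ≡ true → rawCount ls v ≤ s
  by v (inj₁ ok) = ≤-trans (ifTransverse M v ok) t≤s
  by v (inj₂ ok) = ≤-trans (ifContaining M v ok) c≤s

arrangement-meets : t ≤ s → c ≤ s → Meets ls t c → length ls ≡ n → Arrangement s n
arrangement-meets {ls = ls} t≤s c≤s M len =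
  map reduceGenerators ls , trans (length-map reduceGenerators ls) len , meets-bounded t≤s c≤s M

length-partial : ∀ m a Ss → m ≤ length Ss → a ≤ 25 → All (λ S → length S ≡ 25) Ss → length (partial m a Ss) ≡ m * a
length-partial zero    a Ss       _         a≤25 _          = refl
length-partial (suc m) a (S ∷ Ss) (s≤s m≤) a≤25 (eq ∷ eqs) = trans (length-++ (take a S)) (cong₂ _+_
  (trans (length-take a S) (m≤n⇒m⊓n≡m (≤-trans a≤25 (≤-reflexive (sym eq)))))
  (length-partial m a Ss m≤ a≤25 eqs))

length-partial-affineSpreads : ∀ m a → m ≤ 6 → a ≤ 25 → length (partial m a affineSpreads) ≡ m * a
length-partial-affineSpreads m a m≤6 a≤25 =
  length-partial m a affineSpreads (≤-trans m≤6 (≤-reflexive (sym length-affineSpreads))) a≤25 length-affineSpread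

length-copies-liftedLines : ∀ k → length (copies k liftedLines) ≡ 125 * k
length-copies-liftedLines k =
  trans (length-copies k liftedLines) (trans (cong (k *_) length-liftedLines) (*-comm k 125))

length-bundle : ∀ r → r ≤ 6 → length (bundle r 25) ≡ 26 * r
length-bundle r r≤6 = begin
  length (bundle r 25)                              ≡⟨ length-++ (copies r (lineAtInfinity ∷ [])) ⟩
  length (copies r (lineAtInfinity ∷ [])) + length (partial r 25 affineSpreads)
    ≡⟨ cong₂ _+_ (length-copies r (lineAtInfinity ∷ [])) (length-partial-affineSpreads r 25 r≤6 ≤-refl) ⟩
  r * 1 + r * 25                                    ≡⟨ *-distribˡ-+ r 1 25 ⟨
  r * 26                                            ≡⟨ *-comm r 26 ⟩
  26 * r                                            ∎
  where open ≡-Reasoning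

-- Hyperplanes not containing π have at most 5 k + m lines, the solids through π at most `a`; hence
-- the last condition.
partial-arrangement : ∀ k m a → m ≤ 6 → a ≤ 25 → a ≤ 5 * k + m → Arrangement (5 * k + m) (125 * k + m * a)
partial-arrangement k m a m≤6 a≤25 a≤ = arrangement-meets
  (+-monoˡ-≤ m (≤-reflexive (*-comm k 5)))
  (≤-trans (+-monoˡ-≤ a (≤-reflexive (*-zeroʳ k))) a≤)
  (meets-++ (meets-copies k meets-lifted) (meets-partial m a))
  (trans (length-++ (copies k liftedLines))
    (cong₂ _+_ (length-copies-liftedLines k) (length-partial-affineSpreads m a m≤6 a≤25)))

-- With q spreads in each of the six solids and one more in r of them, a solid through π contains at
-- most 31 q + r + 25 lines. This is 25 (q + 1) + 6 q + r, which `5 * suc q ≤ k` keeps within s.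
full-arrangement : ∀ k q r → 5 * suc q ≤ k → r ≤ 6 → Arrangement (5 * k + (6 * q + r)) (125 * k + (156 * q + 26 * r))
full-arrangement k q r 5q≤k r≤6 = arrangement-meets
  (+-mono-≤ (≤-reflexive (*-comm k 5)) (+-monoˡ-≤ r (≤-reflexive (*-comm q 6))))
  (begin
    k * 0 + (q * 31 + (r + 25))          ≡⟨ arith k q r ⟩
    5 * (5 * suc q) + (6 * q + r)        ≤⟨ +-monoˡ-≤ (6 * q + r) (*-monoʳ-≤ 5 5q≤k) ⟩
    5 * k + (6 * q + r)                  ∎)
  (meets-++ (meets-copies k meets-lifted) (meets-++ (meets-copies q (meets-bundle 6 25)) (meets-bundle r 25)))
  (trans (length-++ (copies k liftedLines)) (cong₂ _+_
    (length-copies-liftedLines k)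
    (trans (length-++ (copies q (bundle 6 25))) (cong₂ _+_
      (trans (length-copies q (bundle 6 25)) (trans (cong (q *_) (length-bundle 6 ≤-refl)) (*-comm q 156)))
      (length-bundle r r≤6)))))
  where
  open ≤-Reasoning
  arith : ∀ k q r → k * 0 + (q * 31 + (r + 25)) ≡ 5 * (5 * suc q) + (6 * q + r)
  arith = solve-∀

-- Values and bounds for a single s

no-arrangement : 6 * n < griesmerSum 5 (5 * (n ∸ s)) → ¬ Arrangement s n
no-arrangement lt arr = <⇒≱ lt (griesmer-bound arr)

-- Griesmer's bound excludes size `suc n` for parameter `suc s`, whose difference is `n ∸ s`; the
-- implicit argument is settled by evaluation.
exactly : ∀ s n → Arrangement (suc s) n → {T (6 * suc n <ᵇ griesmerSum 5 (5 * (n ∸ s)))} → n⟨ suc s ⟩≡ n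
exactly s n arr {check} = maximumSize arr (no-arrangement (<ᵇ⇒< (6 * suc n) _ check))

between : ∀ s lo hi {n} → Arrangement (suc s) n → {T (lo ≤ᵇ n)} → {T (6 * suc hi <ᵇ griesmerSum 5 (5 * (hi ∸ s)))} →
  lo ≤n⟨ suc s ⟩≤ hi
between s lo hi arr {lo≤n} {check} =
  maximum-between (arrangement-≤ (≤ᵇ⇒≤ lo _ lo≤n) arr) (no-arrangement (<ᵇ⇒< (6 * suc hi) _ check))

within : n⟨ s ⟩≡ n → {T (lo ≤ᵇ n)} → {T (n ≤ᵇ hi)} → lo ≤n⟨ s ⟩≤ hi
within max {lo≤n} {n≤hi} = _ , max , ≤ᵇ⇒≤ _ _ lo≤n , ≤ᵇ⇒≤ _ _ n≤hi

partialSpreads : ∀ k m a → {T (m ≤ᵇ 6)} → {T (a ≤ᵇ 25)} → {T (a ≤ᵇ 5 * k + m)} → Arrangement (5 * k + m) (125 * k + m * a)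
partialSpreads k m a {p} {q} {r} = partial-arrangement k m a (≤ᵇ⇒≤ m 6 p) (≤ᵇ⇒≤ a 25 q) (≤ᵇ⇒≤ a _ r)

fullSpreads : ∀ m → {T (m ≤ᵇ 6)} → Arrangement (25 + m) (625 + 26 * m)
fullSpreads m {p} = full-arrangement 5 0 m ≤-refl (≤ᵇ⇒≤ m 6 p)

-- Periodicity in s with period 31

ceiling-* : ∀ x d → (5 * x + d + 4) / 5 ≡ x + (d + 4) / 5
ceiling-* x d = begin
  (5 * x + d + 4) / 5             ≡⟨ cong (_/ 5) (+-assoc (5 * x) d 4) ⟩
  (5 * x + (d + 4)) / 5           ≡⟨ +-distrib-/-∣ˡ (d + 4) (m∣m*n x) ⟩
  5 * x / 5 + (d + 4) / 5         ≡⟨ cong (λ y → y / 5 + (d + 4) / 5) (*-comm 5 x) ⟩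
  x * 5 / 5 + (d + 4) / 5         ≡⟨ cong (_+ (d + 4) / 5) (m*n/n≡m x 5) ⟩
  x + (d + 4) / 5                 ∎
  where open ≡-Reasoning

griesmerSum-suc : ∀ k x d → griesmerSum (suc k) (5 * x + d) ≡ 5 * x + d + griesmerSum k (x + (d + 4) / 5)
griesmerSum-suc k x d = cong (λ y → 5 * x + d + griesmerSum k y) (ceiling-* x d)

-- Since 3750 = 6 · 5⁴, the shift passes exactly through all the ceilings: 3750 + 750 + 150 + 30 + 6
-- = 4686 = 6 · 781.
griesmerSum-period : ∀ t d → griesmerSum 5 (3750 * t + d) ≡ 4686 * t + griesmerSum 5 d
griesmerSum-period t d₀ = begin
  griesmerSum 5 (3750 * t + d₀)
    ≡⟨ step 4 750 ⟩
  3750 * t + d₀ + griesmerSum 4 (750 * t + d₁)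
    ≡⟨ cong (3750 * t + d₀ +_) (step 3 150) ⟩
  3750 * t + d₀ + (750 * t + d₁ + griesmerSum 3 (150 * t + d₂))
    ≡⟨ cong (λ y → 3750 * t + d₀ + (750 * t + d₁ + y)) (step 2 30) ⟩
  3750 * t + d₀ + (750 * t + d₁ + (150 * t + d₂ + griesmerSum 2 (30 * t + d₃)))
    ≡⟨ cong (λ y → 3750 * t + d₀ + (750 * t + d₁ + (150 * t + d₂ + y))) (step 1 6) ⟩
  3750 * t + d₀ + (750 * t + d₁ + (150 * t + d₂ + (30 * t + d₃ + (6 * t + d₄ + 0))))
    ≡⟨ collect t d₀ d₁ d₂ d₃ d₄ ⟩
  4686 * t + griesmerSum 5 d₀ ∎
  where
  open ≡-Reasoning
  d₁ d₂ d₃ d₄ : ℕ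
  d₁ = (d₀ + 4) / 5
  d₂ = (d₁ + 4) / 5
  d₃ = (d₂ + 4) / 5
  d₄ = (d₃ + 4) / 5
  step : ∀ k c {d} → griesmerSum (suc k) (5 * c * t + d) ≡ 5 * c * t + d + griesmerSum k (c * t + (d + 4) / 5)
  step k c {d} = subst (λ y → griesmerSum (suc k) (y + d) ≡ y + d + griesmerSum k (c * t + (d + 4) / 5))
    (sym (*-assoc 5 c t)) (griesmerSum-suc k (c * t) d)
  collect : ∀ t a b c d e → 3750 * t + a + (750 * t + b + (150 * t + c + (30 * t + d + (6 * t + e + 0)))) ≡
    4686 * t + (a + (b + (c + (d + (e + 0)))))
  collect = solve-∀

-- For s = 31 t ∸ j the optimum consists of 5 t ∸ c copies of the lifted lines and of
-- 6 t + 5 c ∸ j spreads, where c = defect j; the three functions after deficiency give these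
-- numbers for t = 2, with the spreads grouped into rounds of one spread in each solid through π.
defect : ℕ → ℕ
defect j = (j ∸ 6) / 5

deficiency : ℕ → ℕ
deficiency j = 26 * j ∸ 5 * defect j

liftedCopies spreadRounds extraSpreads : ℕ → ℕ
liftedCopies j = 10 ∸ defect j
spreadRounds j = (12 + 5 * defect j ∸ j ∸ 1) / 6
extraSpreads j = 12 + 5 * defect j ∸ j ∸ 6 * spreadRounds j

-- All conditions at t = 2, decided by evaluation. The requirement on `lifts` charges a further
-- round for the extra spreads, so `spreadRounds` is chosen to leave one to six of them, not zero to
-- five.
admissible : ℕ → Bool
admissible j =
  (j ≤ᵇ 61) ∧ ((5 * suc rounds ≤ᵇ lifts) ∧ ((extra ≤ᵇ 6) ∧ ((5 * lifts + (6 * rounds + extra) ≡ᵇ 62 ∸ j) ∧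
  ((125 * lifts + (156 * rounds + 26 * extra) ≡ᵇ 1562 ∸ deficiency j) ∧ ((deficiency j ≤ᵇ 1562) ∧ ((62 ∸ j ≤ᵇ suc (1562 ∸ deficiency j)) ∧
  (6 * suc (1562 ∸ deficiency j) <ᵇ griesmerSum 5 (5 * (suc (1562 ∸ deficiency j) ∸ (62 ∸ j))))))))))
  where
  lifts = liftedCopies j
  rounds = spreadRounds j
  extra = extraSpreads j

∧-T : ∀ {a b} → T (a ∧ b) → T a × T b
∧-T {true} p = _ , p

maximumSize-pos : 1 ≤ s → Arrangement s n → ¬ Arrangement s (suc n) → n⟨ s ⟩≡ n
maximumSize-pos {suc s} _ = maximumSize

shift-∸ : ∀ c m j → j ≤ 2 * c → c * (2 + m) ∸ j ≡ c * m + (2 * c ∸ j)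
shift-∸ c m j j≤ = trans (cong (_∸ j) (arith c m)) (+-∸-assoc (c * m) j≤)
  where
  arith : ∀ c m → c * (2 + m) ≡ c * m + 2 * c
  arith = solve-∀

-- Each period adds five copies of the lifted lines and one spread in each solid: 31 = 25 + 6 and
-- 781 = 625 + 156, while both sides of the requirement grow by 5.
family-lower : ∀ m k q r → 5 * suc q ≤ k → r ≤ 6 →
  Arrangement (31 * m + (5 * k + (6 * q + r))) (781 * m + (125 * k + (156 * q + 26 * r)))
family-lower m k q r 5q≤k r≤6 = subst₂ Arrangement (arith₁ m k q r) (arith₂ m k q r)
  (full-arrangement (5 * m + k) (m + q) r
    (≤-trans (≤-reflexive (arith₃ m q)) (+-monoʳ-≤ (5 * m) 5q≤k)) r≤6)
  where
  arith₁ : ∀ m k q r → 5 * (5 * m + k) + (6 * (m + q) + r) ≡ 31 * m + (5 * k + (6 * q + r))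
  arith₁ = solve-∀
  arith₂ : ∀ m k q r → 125 * (5 * m + k) + (156 * (m + q) + 26 * r) ≡ 781 * m + (125 * k + (156 * q + 26 * r))
  arith₂ = solve-∀
  arith₃ : ∀ m q → 5 * suc (m + q) ≡ 5 * m + 5 * suc q
  arith₃ = solve-∀

-- Each period adds 5 (781 - 31) = 3750 to the distance, so both sides of the strict inequality grow
-- by 4686.
family-upper : ∀ m s n → s ≤ suc n → 6 * suc n < griesmerSum 5 (5 * (suc n ∸ s)) → ¬ Arrangement (31 * m + s) (suc (781 * m + n))
family-upper m s n s≤ lt = no-arrangement (begin-strict
  6 * suc (781 * m + n)                                 ≡⟨ arith₁ m n ⟩
  4686 * m + 6 * suc n                                  <⟨ +-monoʳ-< (4686 * m) lt ⟩
  4686 * m + griesmerSum 5 (5 * (suc n ∸ s))            ≡⟨ griesmerSum-period m (5 * (suc n ∸ s)) ⟨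
  griesmerSum 5 (3750 * m + 5 * (suc n ∸ s))            ≡⟨ cong (griesmerSum 5) distance ⟨
  griesmerSum 5 (5 * (suc (781 * m + n) ∸ (31 * m + s))) ∎)
  where
  open ≤-Reasoning
  arith₁ : ∀ m n → 6 * suc (781 * m + n) ≡ 4686 * m + 6 * suc n
  arith₁ = solve-∀
  arith₂ : ∀ m n → suc (781 * m + n) ≡ 31 * m + (750 * m + suc n)
  arith₂ = solve-∀
  arith₃ : ∀ m x → 5 * (750 * m + x) ≡ 3750 * m + 5 * x
  arith₃ = solve-∀
  distance : 5 * (suc (781 * m + n) ∸ (31 * m + s)) ≡ 3750 * m + 5 * (suc n ∸ s)
  distance = trans (cong (5 *_) (trans (cong (_∸ (31 * m + s)) (arith₂ m n))
    (trans ([m+n]∸[m+o]≡n∸o (31 * m) (750 * m + suc n) s) (+-∸-assoc (750 * m) s≤)))) (arith₃ m (suc n ∸ s))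

-- Writing t as 2 + m reduces every t to the finite conditions at t = 2.
family : ∀ j t → 2 ≤ t → {T (admissible j)} → n⟨ 31 * t ∸ j ⟩≡ (781 * t ∸ deficiency j)
family j (suc (suc m)) (s≤s (s≤s z≤n)) {ok} =
  let j≤61 , ok₁ = ∧-T {j ≤ᵇ 61} ok
      5q≤k , ok₂ = ∧-T {5 * suc (spreadRounds j) ≤ᵇ liftedCopies j} ok₁
      r≤6  , ok₃ = ∧-T {extraSpreads j ≤ᵇ 6} ok₂
      s≡   , ok₄ = ∧-T {5 * liftedCopies j + (6 * spreadRounds j + extraSpreads j) ≡ᵇ 62 ∸ j} ok₃
      n≡   , ok₅ = ∧-T {125 * liftedCopies j + (156 * spreadRounds j + 26 * extraSpreads j) ≡ᵇ 1562 ∸ deficiency j} ok₄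
      d≤   , ok₆ = ∧-T {deficiency j ≤ᵇ 1562} ok₅
      s≤   , lt  = ∧-T {62 ∸ j ≤ᵇ suc (1562 ∸ deficiency j)} ok₆
      j≤ = ≤ᵇ⇒≤ j 61 j≤61
      lower = family-lower m (liftedCopies j) (spreadRounds j) (extraSpreads j) (≤ᵇ⇒≤ _ _ 5q≤k) (≤ᵇ⇒≤ _ _ r≤6)
      s-eq = trans (shift-∸ 31 m j (m≤n⇒m≤1+n j≤)) (cong (31 * m +_) (sym (≡ᵇ⇒≡ _ _ s≡)))
      n-eq = trans (shift-∸ 781 m (deficiency j) (≤ᵇ⇒≤ _ _ d≤)) (cong (781 * m +_) (sym (≡ᵇ⇒≡ _ _ n≡)))
      s-eq′ = shift-∸ 31 m j (m≤n⇒m≤1+n j≤)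
      n-eq′ = shift-∸ 781 m (deficiency j) (≤ᵇ⇒≤ _ _ d≤)
  in maximumSize-pos
       (subst (1 ≤_) (sym s-eq′) (≤-trans (m<n⇒0<n∸m (s≤s j≤)) (m≤n+m (62 ∸ j) (31 * m))))
       (subst₂ Arrangement (sym s-eq) (sym n-eq) lower)
       (subst₂ (λ s n → ¬ Arrangement s (suc n)) (sym s-eq′) (sym n-eq′)
         (family-upper m (62 ∸ j) (1562 ∸ deficiency j) (≤ᵇ⇒≤ _ _ s≤) (<ᵇ⇒< _ _ lt)))


-- Arrangements found by computer search

-- The entries of a vector are the five decimal digits of a number.
digits : ℕ → RawVector 5
digits n = n / 10000 % 10 ∷ n / 1000 % 10 ∷ n / 100 % 10 ∷ n / 10 % 10 ∷ n % 10 ∷ []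

⟨_,_⟩ : ℕ → ℕ → RawGenerators
⟨ v , w ⟩ = digits v , digits w

matrix : ℕ → ℕ → ℕ → ℕ → ℕ → Matrix
matrix a b c d e = digits a ∷ digits b ∷ digits c ∷ digits d ∷ digits e ∷ []

-- The matrices of multiplication by x²⁸⁴ (of order 11) and of y ↦ y⁵ on the field
-- 𝔽₅[x]/(x⁵ − 3x⁴ − 2), in the basis 1, x, …, x⁴.
singer frobenius : Matrix
singer    = matrix 22412 22241 22224 42222 12310
frobenius = matrix 12030 00213 00442 00323 03143

-- Block-diagonal matrices of orders 8 and 12.
A₈ A₁₂ : Matrix
A₈  = matrix 42000 11000 00300 00030 00001
A₁₂ = matrix 31000 01000 00220 00140 00002

-- Commuting unipotent matrices of order 5, which generate a group of order 25.
U V : Matrix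
U = matrix 14202 01233 00120 00014 00001
V = matrix 12000 01112 00114 00012 00001

-- `frobenius` normalises the group generated by `singer`; together they generate a group of order
-- 55.
orbit₁₁ orbit₅₅ : List RawGenerators → List RawGenerators
orbit₁₁ = concatMap (orbit 11 singer)
orbit₅₅ Ls = orbit₁₁ (concatMap (orbit 5 frobenius) Ls)

abstract
  arrangement-2-27 : Arrangement 2 27
  arrangement-2-27 = arrangement-raw
    (orbit 8 A₈ ⟨ 01012 , 10441 ⟩ ++ orbit 8 A₈ ⟨ 01103 , 10020 ⟩ ++ orbit 8 A₈ ⟨ 01114 , 10413 ⟩ ++
     orbit 2 A₈ ⟨ 00001 , 10000 ⟩ ++ ⟨ 00010 , 00100 ⟩ ∷ []) refl

  arrangement-3-50 : Arrangement 3 50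
  arrangement-3-50 = arrangement-raw
    (concatMap (orbit 12 A₁₂) (⟨ 01010 , 10424 ⟩ ∷ ⟨ 00011 , 11300 ⟩ ∷ ⟨ 01013 , 10202 ⟩ ∷ ⟨ 01023 , 10410 ⟩ ∷ []) ++
     ⟨ 00001 , 13000 ⟩ ∷ ⟨ 01000 , 10000 ⟩ ∷ []) refl

  arrangement-4-77 : Arrangement 4 77
  arrangement-4-77 = arrangement-raw (orbit₁₁
    (⟨ 00104 , 10001 ⟩ ∷ ⟨ 00011 , 11203 ⟩ ∷ ⟨ 00111 , 10033 ⟩ ∷ ⟨ 00012 , 13302 ⟩ ∷ ⟨ 00010 , 01103 ⟩ ∷
     ⟨ 00014 , 13403 ⟩ ∷ ⟨ 00001 , 10240 ⟩ ∷ [])) refl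

  arrangement-6-132 : Arrangement 6 132
  arrangement-6-132 = arrangement-raw (orbit₁₁
    (⟨ 00013 , 10301 ⟩ ∷ ⟨ 00131 , 14031 ⟩ ∷ ⟨ 00001 , 11200 ⟩ ∷ ⟨ 00123 , 13002 ⟩ ∷ ⟨ 00010 , 11100 ⟩ ∷
     ⟨ 01034 , 10102 ⟩ ∷ ⟨ 00113 , 13041 ⟩ ∷ ⟨ 00012 , 01203 ⟩ ∷ ⟨ 00102 , 13032 ⟩ ∷ ⟨ 00011 , 10000 ⟩ ∷
     ⟨ 00103 , 10014 ⟩ ∷ ⟨ 00100 , 10024 ⟩ ∷ [])) refl

  arrangement-7-157 : Arrangement 7 157
  arrangement-7-157 = arrangement-raw
    (⟨ 00001 , 01000 ⟩ ∷ ⟨ 00001 , 10000 ⟩ ∷ ⟨ 00001 , 11000 ⟩ ∷ ⟨ 00001 , 14000 ⟩ ∷ ⟨ 00010 , 00100 ⟩ ∷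
     ⟨ 00010 , 00102 ⟩ ∷ ⟨ 00011 , 00100 ⟩ ∷ ⟨ 00012 , 00103 ⟩ ∷ ⟨ 00013 , 00101 ⟩ ∷ ⟨ 00014 , 00104 ⟩ ∷
     ⟨ 00123 , 13004 ⟩ ∷ ⟨ 00124 , 12001 ⟩ ∷ ⟨ 01010 , 10204 ⟩ ∷ ⟨ 01011 , 10100 ⟩ ∷ ⟨ 01012 , 10232 ⟩ ∷
     ⟨ 01012 , 10240 ⟩ ∷ ⟨ 01013 , 10210 ⟩ ∷ ⟨ 01014 , 10321 ⟩ ∷ ⟨ 01020 , 10402 ⟩ ∷ ⟨ 01021 , 10411 ⟩ ∷
     ⟨ 01021 , 10430 ⟩ ∷ ⟨ 01022 , 10143 ⟩ ∷ ⟨ 01023 , 10200 ⟩ ∷ ⟨ 01024 , 10420 ⟩ ∷ ⟨ 01030 , 10103 ⟩ ∷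
     ⟨ 01031 , 10130 ⟩ ∷ ⟨ 01032 , 10300 ⟩ ∷ ⟨ 01033 , 10412 ⟩ ∷ ⟨ 01034 , 10120 ⟩ ∷ ⟨ 01034 , 10144 ⟩ ∷
     ⟨ 01040 , 10301 ⟩ ∷ ⟨ 01041 , 10234 ⟩ ∷ ⟨ 01042 , 10340 ⟩ ∷ ⟨ 01043 , 10310 ⟩ ∷ ⟨ 01043 , 10323 ⟩ ∷
     ⟨ 01044 , 10400 ⟩ ∷ ⟨ 01100 , 10212 ⟩ ∷ ⟨ 01101 , 10332 ⟩ ∷ ⟨ 01102 , 10222 ⟩ ∷ ⟨ 01103 , 10134 ⟩ ∷
     ⟨ 01104 , 10213 ⟩ ∷ ⟨ 01104 , 10230 ⟩ ∷ ⟨ 01110 , 10311 ⟩ ∷ ⟨ 01111 , 10434 ⟩ ∷ ⟨ 01112 , 10142 ⟩ ∷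
     ⟨ 01113 , 10044 ⟩ ∷ ⟨ 01113 , 10434 ⟩ ∷ ⟨ 01114 , 10204 ⟩ ∷ ⟨ 01120 , 10413 ⟩ ∷ ⟨ 01121 , 10201 ⟩ ∷
     ⟨ 01122 , 10341 ⟩ ∷ ⟨ 01123 , 10022 ⟩ ∷ ⟨ 01123 , 10132 ⟩ ∷ ⟨ 01124 , 10330 ⟩ ∷ ⟨ 01130 , 10414 ⟩ ∷
     ⟨ 01131 , 10033 ⟩ ∷ ⟨ 01132 , 10021 ⟩ ∷ ⟨ 01132 , 10113 ⟩ ∷ ⟨ 01133 , 10101 ⟩ ∷ ⟨ 01134 , 10443 ⟩ ∷
     ⟨ 01140 , 10431 ⟩ ∷ ⟨ 01141 , 10040 ⟩ ∷ ⟨ 01141 , 10332 ⟩ ∷ ⟨ 01142 , 10042 ⟩ ∷ ⟨ 01143 , 10122 ⟩ ∷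
     ⟨ 01144 , 10303 ⟩ ∷ ⟨ 01200 , 10421 ⟩ ∷ ⟨ 01201 , 10441 ⟩ ∷ ⟨ 01202 , 10410 ⟩ ∷ ⟨ 01202 , 10424 ⟩ ∷
     ⟨ 01203 , 10111 ⟩ ∷ ⟨ 01204 , 10212 ⟩ ∷ ⟨ 01210 , 10322 ⟩ ∷ ⟨ 01211 , 10043 ⟩ ∷ ⟨ 01211 , 10224 ⟩ ∷
     ⟨ 01212 , 10334 ⟩ ∷ ⟨ 01213 , 10014 ⟩ ∷ ⟨ 01214 , 10203 ⟩ ∷ ⟨ 01220 , 10123 ⟩ ∷ ⟨ 01221 , 10231 ⟩ ∷
     ⟨ 01222 , 10402 ⟩ ∷ ⟨ 01223 , 10312 ⟩ ∷ ⟨ 01224 , 10032 ⟩ ∷ ⟨ 01224 , 10312 ⟩ ∷ ⟨ 01230 , 10313 ⟩ ∷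
     ⟨ 01231 , 10031 ⟩ ∷ ⟨ 01232 , 10104 ⟩ ∷ ⟨ 01233 , 10030 ⟩ ∷ ⟨ 01233 , 10111 ⟩ ∷ ⟨ 01234 , 10241 ⟩ ∷
     ⟨ 01240 , 10324 ⟩ ∷ ⟨ 01241 , 10133 ⟩ ∷ ⟨ 01242 , 10110 ⟩ ∷ ⟨ 01243 , 10403 ⟩ ∷ ⟨ 01244 , 10041 ⟩ ∷
     ⟨ 01244 , 10211 ⟩ ∷ ⟨ 01300 , 10134 ⟩ ∷ ⟨ 01301 , 10343 ⟩ ∷ ⟨ 01302 , 10444 ⟩ ∷ ⟨ 01303 , 10131 ⟩ ∷
     ⟨ 01303 , 10140 ⟩ ∷ ⟨ 01304 , 10114 ⟩ ∷ ⟨ 01310 , 10120 ⟩ ∷ ⟨ 01310 , 10231 ⟩ ∷ ⟨ 01311 , 10014 ⟩ ∷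
     ⟨ 01311 , 10344 ⟩ ∷ ⟨ 01312 , 10102 ⟩ ∷ ⟨ 01313 , 10440 ⟩ ∷ ⟨ 01314 , 10422 ⟩ ∷ ⟨ 01320 , 10242 ⟩ ∷
     ⟨ 01321 , 10314 ⟩ ∷ ⟨ 01322 , 10020 ⟩ ∷ ⟨ 01322 , 10444 ⟩ ∷ ⟨ 01323 , 10401 ⟩ ∷ ⟨ 01324 , 10024 ⟩ ∷
     ⟨ 01330 , 10432 ⟩ ∷ ⟨ 01331 , 10023 ⟩ ∷ ⟨ 01331 , 10243 ⟩ ∷ ⟨ 01332 , 10243 ⟩ ∷ ⟨ 01333 , 10103 ⟩ ∷
     ⟨ 01334 , 10324 ⟩ ∷ ⟨ 01340 , 10233 ⟩ ∷ ⟨ 01341 , 10302 ⟩ ∷ ⟨ 01342 , 10041 ⟩ ∷ ⟨ 01343 , 10221 ⟩ ∷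
     ⟨ 01344 , 10012 ⟩ ∷ ⟨ 01344 , 10331 ⟩ ∷ ⟨ 01400 , 10343 ⟩ ∷ ⟨ 01401 , 10320 ⟩ ∷ ⟨ 01401 , 10342 ⟩ ∷
     ⟨ 01402 , 10421 ⟩ ∷ ⟨ 01403 , 10333 ⟩ ∷ ⟨ 01404 , 10223 ⟩ ∷ ⟨ 01410 , 10124 ⟩ ∷ ⟨ 01411 , 10202 ⟩ ∷
     ⟨ 01412 , 10433 ⟩ ∷ ⟨ 01413 , 10013 ⟩ ∷ ⟨ 01414 , 10010 ⟩ ∷ ⟨ 01414 , 10223 ⟩ ∷ ⟨ 01420 , 10141 ⟩ ∷
     ⟨ 01421 , 10112 ⟩ ∷ ⟨ 01422 , 10404 ⟩ ∷ ⟨ 01423 , 10034 ⟩ ∷ ⟨ 01423 , 10442 ⟩ ∷ ⟨ 01424 , 10022 ⟩ ∷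
     ⟨ 01430 , 10142 ⟩ ∷ ⟨ 01431 , 10220 ⟩ ∷ ⟨ 01432 , 10033 ⟩ ∷ ⟨ 01432 , 10423 ⟩ ∷ ⟨ 01433 , 10214 ⟩ ∷
     ⟨ 01434 , 10304 ⟩ ∷ ⟨ 01440 , 10244 ⟩ ∷ ⟨ 01441 , 10301 ⟩ ∷ ⟨ 01442 , 10011 ⟩ ∷ ⟨ 01442 , 10121 ⟩ ∷
     ⟨ 01443 , 10413 ⟩ ∷ ⟨ 01444 , 10121 ⟩ ∷ []) refl

  arrangement-8-176 : Arrangement 8 176
  arrangement-8-176 = arrangement-raw
    (orbit₅₅ (⟨ 00001 , 12300 ⟩ ∷ ⟨ 00013 , 10200 ⟩ ∷ ⟨ 00012 , 11304 ⟩ ∷ []) ++ orbit₁₁ (⟨ 00013 , 10000 ⟩ ∷ [])) refl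

  arrangement-12-286 : Arrangement 12 286
  arrangement-12-286 = arrangement-raw
    (orbit₅₅ (⟨ 00001 , 11410 ⟩ ∷ ⟨ 00112 , 10004 ⟩ ∷ ⟨ 00001 , 13020 ⟩ ∷ ⟨ 00101 , 11044 ⟩ ∷ ⟨ 00012 , 00104 ⟩ ∷ []) ++
     orbit₁₁ (⟨ 00013 , 10000 ⟩ ∷ [])) refl

  arrangement-13-308 : Arrangement 13 308
  arrangement-13-308 = arrangement-raw
    (orbit₅₅ (⟨ 00001 , 11020 ⟩ ∷ ⟨ 00011 , 11202 ⟩ ∷ ⟨ 00012 , 10402 ⟩ ∷ ⟨ 00101 , 13022 ⟩ ∷ ⟨ 00001 , 13010 ⟩ ∷ []) ++
     orbit₁₁ (⟨ 00013 , 10000 ⟩ ∷ ⟨ 00013 , 10000 ⟩ ∷ ⟨ 00013 , 10000 ⟩ ∷ [])) refl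

  arrangement-14-330 : Arrangement 14 330
  arrangement-14-330 = arrangement-raw (orbit₅₅
    (⟨ 00011 , 10402 ⟩ ∷ ⟨ 00001 , 10030 ⟩ ∷ ⟨ 00014 , 10202 ⟩ ∷ ⟨ 00001 , 12120 ⟩ ∷ ⟨ 00014 , 14404 ⟩ ∷
     ⟨ 00011 , 12203 ⟩ ∷ [])) refl

  arrangement-17-412 : Arrangement 17 412
  arrangement-17-412 = arrangement-raw
    (concatMap (orbit 5 U) (concatMap (orbit 5 V)
       (⟨ 00101 , 10032 ⟩ ∷ ⟨ 00112 , 10024 ⟩ ∷ ⟨ 00013 , 14201 ⟩ ∷ ⟨ 00011 , 01103 ⟩ ∷ ⟨ 00013 , 12103 ⟩ ∷
        ⟨ 00014 , 13401 ⟩ ∷ ⟨ 00013 , 01303 ⟩ ∷ ⟨ 00001 , 10120 ⟩ ∷ ⟨ 00011 , 01203 ⟩ ∷ ⟨ 00001 , 14440 ⟩ ∷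
        ⟨ 00104 , 11031 ⟩ ∷ ⟨ 00001 , 13430 ⟩ ∷ ⟨ 00101 , 14024 ⟩ ∷ ⟨ 00013 , 11303 ⟩ ∷ ⟨ 00001 , 10420 ⟩ ∷
        ⟨ 00010 , 11003 ⟩ ∷ [])) ++
     concatMap (orbit 5 U) (⟨ 00100 , 14000 ⟩ ∷ ⟨ 00100 , 10000 ⟩ ∷ []) ++
     ⟨ 01000 , 10000 ⟩ ∷ ⟨ 01000 , 10000 ⟩ ∷ []) refl

theorem7 : ((27 ≤n⟨ 2 ⟩≤ 31) ×
    (50 ≤n⟨ 3 ⟩≤ 62) ×
    (77 ≤n⟨ 4 ⟩≤ 93) ×
    (n⟨ 5 ⟩≡ 125) ×
    (132 ≤n⟨ 6 ⟩≤ 146) ×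
    (157 ≤n⟨ 7 ⟩≤ 172) ×
    (176 ≤n⟨ 8 ⟩≤ 198) ×
    (202 ≤n⟨ 9 ⟩≤ 224) ×
    (n⟨ 10 ⟩≡ 250) ×
    (260 ≤n⟨ 11 ⟩≤ 271) ×
    (286 ≤n⟨ 12 ⟩≤ 297) ×
    (308 ≤n⟨ 13 ⟩≤ 323) ×
    (330 ≤n⟨ 14 ⟩≤ 349) ×
    (n⟨ 15 ⟩≡ 375) ×
    (391 ≤n⟨ 16 ⟩≤ 396) ×
    (412 ≤n⟨ 17 ⟩≤ 422) ×
    (433 ≤n⟨ 18 ⟩≤ 448) ×
    (455 ≤n⟨ 19 ⟩≤ 474) ×
    (n⟨ 20 ⟩≡ 500) ×
    (n⟨ 21 ⟩≡ 521) ×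
    (542 ≤n⟨ 22 ⟩≤ 547) ×
    (568 ≤n⟨ 23 ⟩≤ 573) ×
    (594 ≤n⟨ 24 ⟩≤ 599) ×
    (n⟨ 25 ⟩≡ 625) ×
    (n⟨ 26 ⟩≡ 651) ×
    (667 ≤n⟨ 27 ⟩≤ 677) ×
    (693 ≤n⟨ 28 ⟩≤ 703) ×
    (719 ≤n⟨ 29 ⟩≤ 729) ×
    (n⟨ 30 ⟩≡ 755) ×
    (n⟨ 31 ⟩≡ 781))
    ×
    ((792 ≤n⟨ 32 ⟩≤ 802) ×
    (818 ≤n⟨ 33 ⟩≤ 828) ×
    (844 ≤n⟨ 34 ⟩≤ 854) ×
    (n⟨ 35 ⟩≡ 880) ×
    (n⟨ 36 ⟩≡ 906) ×
    (n⟨ 37 ⟩≡ 927) ×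
    (941 ≤n⟨ 38 ⟩≤ 953) ×
    (969 ≤n⟨ 39 ⟩≤ 979) ×
    (n⟨ 40 ⟩≡ 1005) ×
    (n⟨ 41 ⟩≡ 1031) ×
    (n⟨ 42 ⟩≡ 1052) ×
    (1067 ≤n⟨ 43 ⟩≤ 1078) ×
    (1096 ≤n⟨ 44 ⟩≤ 1104) ×
    (n⟨ 45 ⟩≡ 1130) ×
    (n⟨ 46 ⟩≡ 1156) ×
    (n⟨ 47 ⟩≡ 1177) ×
    (n⟨ 48 ⟩≡ 1203) ×
    (1224 ≤n⟨ 49 ⟩≤ 1229) ×
    (n⟨ 50 ⟩≡ 1255) ×
    (n⟨ 51 ⟩≡ 1281) ×
    (n⟨ 52 ⟩≡ 1302) ×
    (n⟨ 53 ⟩≡ 1328) ×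
    (n⟨ 54 ⟩≡ 1354) ×
    (n⟨ 55 ⟩≡ 1380) ×
    (n⟨ 56 ⟩≡ 1406) ×
    (n⟨ 57 ⟩≡ 1432) ×
    (n⟨ 58 ⟩≡ 1458) ×
    (n⟨ 59 ⟩≡ 1484) ×
    (n⟨ 60 ⟩≡ 1510) ×
    (n⟨ 61 ⟩≡ 1536) ×
    (n⟨ 62 ⟩≡ 1562))
    ×
    ((t : ℕ) → 3 ≤ t →
    (n⟨ 31 * t ∸ 30 ⟩≡ 781 * t ∸ 760) ×
    (n⟨ 31 * t ∸ 29 ⟩≡ 781 * t ∸ 734) ×
    (n⟨ 31 * t ∸ 28 ⟩≡ 781 * t ∸ 708) ×
    (n⟨ 31 * t ∸ 27 ⟩≡ 781 * t ∸ 682) ×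
    (n⟨ 31 * t ∸ 26 ⟩≡ 781 * t ∸ 656) ×
    (n⟨ 31 * t ∸ 25 ⟩≡ 781 * t ∸ 635) ×
    (n⟨ 31 * t ∸ 24 ⟩≡ 781 * t ∸ 609) ×
    (n⟨ 31 * t ∸ 23 ⟩≡ 781 * t ∸ 583) ×
    (n⟨ 31 * t ∸ 22 ⟩≡ 781 * t ∸ 557) ×
    (n⟨ 31 * t ∸ 21 ⟩≡ 781 * t ∸ 531) ×
    (n⟨ 31 * t ∸ 20 ⟩≡ 781 * t ∸ 510) ×
    (n⟨ 31 * t ∸ 19 ⟩≡ 781 * t ∸ 484) ×
    (n⟨ 31 * t ∸ 18 ⟩≡ 781 * t ∸ 458) ×
    (n⟨ 31 * t ∸ 17 ⟩≡ 781 * t ∸ 432) ×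
    (n⟨ 31 * t ∸ 16 ⟩≡ 781 * t ∸ 406) ×
    (n⟨ 31 * t ∸ 15 ⟩≡ 781 * t ∸ 385) ×
    (n⟨ 31 * t ∸ 14 ⟩≡ 781 * t ∸ 359) ×
    (n⟨ 31 * t ∸ 13 ⟩≡ 781 * t ∸ 333) ×
    (n⟨ 31 * t ∸ 12 ⟩≡ 781 * t ∸ 307) ×
    (n⟨ 31 * t ∸ 11 ⟩≡ 781 * t ∸ 281) ×
    (n⟨ 31 * t ∸ 10 ⟩≡ 781 * t ∸ 260) ×
    (n⟨ 31 * t ∸ 9 ⟩≡ 781 * t ∸ 234) ×
    (n⟨ 31 * t ∸ 8 ⟩≡ 781 * t ∸ 208) ×
    (n⟨ 31 * t ∸ 7 ⟩≡ 781 * t ∸ 182) ×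
    (n⟨ 31 * t ∸ 6 ⟩≡ 781 * t ∸ 156) ×
    (n⟨ 31 * t ∸ 5 ⟩≡ 781 * t ∸ 130) ×
    (n⟨ 31 * t ∸ 4 ⟩≡ 781 * t ∸ 104) ×
    (n⟨ 31 * t ∸ 3 ⟩≡ 781 * t ∸ 78) ×
    (n⟨ 31 * t ∸ 2 ⟩≡ 781 * t ∸ 52) ×
    (n⟨ 31 * t ∸ 1 ⟩≡ 781 * t ∸ 26) ×
    (n⟨ 31 * t ⟩≡ 781 * t))
theorem7 =
  -- The three dividends are 775 σ for σ = 1, 2, 3.
  ( maximum-between arrangement-2-27 (no-tight-arrangement 1 (s≤s z≤n) (from-no (2 ∣? 775))) ,
    maximum-between arrangement-3-50 (no-tight-arrangement 2 (s≤s z≤n) (from-no (3 ∣? 1550))) ,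
    maximum-between arrangement-4-77 (no-tight-arrangement 3 (s≤s z≤n) (from-no (4 ∣? 2325))) ,
    exactly 4 125 (partialSpreads 1 0 0) ,
    between 5 132 146 arrangement-6-132 ,
    between 6 157 172 arrangement-7-157 ,
    between 7 176 198 arrangement-8-176 ,
    between 8 202 224 (arrangement-+ arrangement-4-77 (partialSpreads 1 0 0)) ,
    exactly 9 250 (partialSpreads 2 0 0) ,
    -- Each partial spread has s lines, the most that a solid may contain; here this gives 250 + 11
    -- lines.
    between 10 260 271 (partialSpreads 2 1 11) ,
    between 11 286 297 arrangement-12-286 ,
    between 12 308 323 arrangement-13-308 ,
    between 13 330 349 arrangement-14-330 ,
    exactly 14 375 (partialSpreads 3 0 0) ,
    between 15 391 396 (partialSpreads 3 1 16) ,
    between 16 412 422 arrangement-17-412 ,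
    between 17 433 448 (arrangement-+ arrangement-13-308 (partialSpreads 1 0 0)) ,
    between 18 455 474 (arrangement-+ arrangement-14-330 (partialSpreads 1 0 0)) ,
    exactly 19 500 (partialSpreads 4 0 0) ,
    exactly 20 521 (partialSpreads 4 1 21) ,
    between 21 542 547 (partialSpreads 4 2 22) ,
    between 22 568 573 (partialSpreads 4 3 23) ,
    between 23 594 599 (partialSpreads 4 4 24) ,
    exactly 24 625 (fullSpreads 0) ,
    exactly 25 651 (fullSpreads 1) ,
    -- For s = 27, 28, 29 the complete spreads reach the upper end of the interval.
    between 26 667 677 (fullSpreads 2) ,
    between 27 693 703 (fullSpreads 3) ,
    between 28 719 729 (fullSpreads 4) ,
    exactly 29 755 (fullSpreads 5) ,
    exactly 30 781 (fullSpreads 6) ) ,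
  -- Wherever `within` is applied, the exact value from `family` is the upper end of the interval.
  ( within (family 30 2 ≤-refl) ,
    within (family 29 2 ≤-refl) ,
    within (family 28 2 ≤-refl) ,
    family 27 2 ≤-refl ,
    family 26 2 ≤-refl ,
    family 25 2 ≤-refl ,
    within (family 24 2 ≤-refl) ,
    within (family 23 2 ≤-refl) ,
    family 22 2 ≤-refl ,
    family 21 2 ≤-refl ,
    family 20 2 ≤-refl ,
    within (family 19 2 ≤-refl) ,
    within (family 18 2 ≤-refl) ,
    family 17 2 ≤-refl ,
    family 16 2 ≤-refl ,
    family 15 2 ≤-refl ,
    family 14 2 ≤-refl ,
    within (family 13 2 ≤-refl) ,
    family 12 2 ≤-refl ,
    family 11 2 ≤-refl ,
    family 10 2 ≤-refl ,
    family 9 2 ≤-refl ,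
    family 8 2 ≤-refl ,
    family 7 2 ≤-refl ,
    family 6 2 ≤-refl ,
    family 5 2 ≤-refl ,
    family 4 2 ≤-refl ,
    family 3 2 ≤-refl ,
    family 2 2 ≤-refl ,
    family 1 2 ≤-refl ,
    family 0 2 ≤-refl ) ,
  λ t 3≤t → let 2≤t = ≤-trans (n≤1+n 2) 3≤t in
      family 30 t 2≤t ,
      family 29 t 2≤t ,
      family 28 t 2≤t ,
      family 27 t 2≤t ,
      family 26 t 2≤t ,
      family 25 t 2≤t ,
      family 24 t 2≤t ,
      family 23 t 2≤t ,
      family 22 t 2≤t ,
      family 21 t 2≤t ,
      family 20 t 2≤t ,
      family 19 t 2≤t ,
      family 18 t 2≤t ,
      family 17 t 2≤t ,
      family 16 t 2≤t ,
      family 15 t 2≤t ,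
      family 14 t 2≤t ,
      family 13 t 2≤t ,
      family 12 t 2≤t ,
      family 11 t 2≤t ,
      family 10 t 2≤t ,
      family 9 t 2≤t ,
      family 8 t 2≤t ,
      family 7 t 2≤t ,
      family 6 t 2≤t ,
      family 5 t 2≤t ,
      family 4 t 2≤t ,
      family 3 t 2≤t ,
      family 2 t 2≤t ,
      family 1 t 2≤t ,
      family 0 t 2≤t
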